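{- For every $n\geq 1$, the map $\Phi$ defined in the context is a bijection from the set of snakes of type $B_n$ to the set of labeled ballot paths of length $n$.
   Context: A signed permutation on $[n]=\{1,\dots,n\}$ is a word $\pi=\pi_1\cdots\pi_n$ obtained from a permutation of $[n]$ by attaching a minus sign to some entries; $\bar{i}$ denotes $-i$. Entries are compared in the order $\bar n<\cdots<\bar 1<1<\cdots<n$. A snake of type $B_n$ is a signed permutation $\pi$ on $[n]$ with $0<\pi_1>\pi_2<\pi_3>\pi_4<\cdots\pi_n$ (alternating inequalities). A ballot path of length $n$ is a lattice path from $(0,0)$ with $n$ steps, each an up step $u=(1,1)$ or a down step $d=(1,-1)$, never going below the $x$-axis. The height of a step is the smaller $y$-coordinate of its two endpoints. A labeled ballot path $(P;W)$, $P=p_1\cdots p_n$, $W=w_1\cdots w_n$, is a ballot path in which each step $p_i$ carries an integer label $w_i$ with $0\le w_i\le$ height of $p_i$. Inversion code: for a snake $\pi$ of type $B_n$ and $1\le i\le n$, let $c_i(\pi)$ be the number of $k$ with $1\le k\le (n-1)/2$, $i<2k$ and $\pi_{2k}<\pi_i<\pi_{2k+1}$ if $n$ is odd, and the number of $k$ with $1\le k\le n/2$, $i<2k-1$ and $\pi_{2k}<\pi_i<\pi_{2k-1}$ if $n$ is even. The map $\Phi$: given a snake $\pi$ of type $B_n$, define steps $p_1,\dots,p_n$ and labels $w_1,\dots,w_n$ successively for $k=1,\dots,n$ as follows. Let $i$ be the position with $\pi_i\in\{n-k+1,\overline{n-k+1}\}$. If $\pi_i=n-k+1$: set $p_k=u$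 if $i$ is odd and $p_k=d$ if $i$ is even, and $w_k=c_i(\pi)$. If $\pi_i=\overline{n-k+1}$: set $p_k=d$ if $i$ is odd and $p_k=u$ if $i$ is even, and $w_k=h_k-c_i(\pi)$, where $h_k$ is the height of the $k$-th step in the path $p_1p_2\cdots p_k$. Then $\Phi(\pi)=(p_1\cdots p_n;w_1\cdots w_n)$. -}

module Defs where

open import Data.Nat as ℕ using (ℕ; zero; suc; _∸_; _/_)
open import Data.Integer as ℤ using (ℤ; +_; ∣_∣; _-_; _<_; _≤_; _>_)
open import Data.Bool using (Bool; true; false; if_then_else_; _∧_; not)
open import Data.Fin using (Fin)
open import Data.Vec using (Vec; []; _∷_; lookup; toList)
open import Data.List using (List; []; _∷_)
open import Data.Product using (_×_; _,_)
open import Relation.Nullary.Decidable using (⌊_⌋)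
open import Relation.Binary.PropositionalEquality using (_≡_)

-- Signed permutations and snakes.
-- A signed permutation on [n] is a word π₁⋯πₙ of integers (entry ī is
-- the integer -i); the order  n̄ < ⋯ < 1̄ < 1 < ⋯ < n  is the integer order.
-- It is obtained from a permutation of [n] by attaching signs exactly when
-- i ↦ |πᵢ| is an injective map from the n positions into [n].

IsSignedPerm : (n : ℕ) → Vec ℤ n → Set
IsSignedPerm n π =
  (∀ i → (1 ℕ.≤ ∣ lookup π i ∣) × (∣ lookup π i ∣ ℕ.≤ n)) ×
  (∀ (i j : Fin n) → ∣ lookup π i ∣ ≡ ∣ lookup π j ∣ → i ≡ j)

-- 1-indexed access to the word; positions outside 1..n give 0 (never used
-- at such positions below for snakes).
at : List ℤ → ℕ → ℤ
at []       _             = + 0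
at (x ∷ xs) zero          = + 0
at (x ∷ xs) (suc zero)    = x
at (x ∷ xs) (suc (suc j)) = at xs (suc j)

isOdd : ℕ → Bool
isOdd zero          = false
isOdd (suc zero)    = true
isOdd (suc (suc m)) = isOdd m

Alternating : (n : ℕ) → Vec ℤ n → Set
Alternating n π = ∀ (j : ℕ) → 1 ℕ.≤ j → j ℕ.< n →
  (if isOdd j then at (toList π) j > at (toList π) (suc j)
              else at (toList π) j < at (toList π) (suc j))

IsSnake : (n : ℕ) → Vec ℤ n → Set
IsSnake n π = IsSignedPerm n π × (+ 0 < at (toList π) 1) × Alternating n π

data Step : Set where
  u d : Step

-- A labeled ballot path is a list of (step, label) pairs; the path
-- P = p₁⋯pₙ and the labels W = w₁⋯wₙ are the two components.
-- LabeledFrom y s : the labeled steps s, starting at height y, never go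
-- below the x-axis and each label wᵢ satisfies 0 ≤ wᵢ ≤ height of pᵢ
-- (height = smaller y-coordinate of the two endpoints).
LabeledFrom : ℕ → List (Step × ℤ) → Set
LabeledFrom y []             = Data.Unit.⊤ where import Data.Unit
LabeledFrom y ((u , w) ∷ s)  = (+ 0 ≤ w) × (w ≤ + y) × LabeledFrom (suc y) s
LabeledFrom zero ((d , w) ∷ s)    = Data.Empty.⊥ where import Data.Empty
LabeledFrom (suc y) ((d , w) ∷ s) = (+ 0 ≤ w) × (w ≤ + y) × LabeledFrom y s

IsLabeledBallotPath : (n : ℕ) → Vec (Step × ℤ) n → Set
IsLabeledBallotPath n s = LabeledFrom 0 (toList s)

countUpTo : ℕ → (ℕ → Bool) → ℕ
countUpTo zero    P = 0
countUpTo (suc m) P = countUpTo m P ℕ.+ (if P (suc m) then 1 else 0)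

ltℤ : ℤ → ℤ → Bool
ltℤ a b = ⌊ a ℤ.<? b ⌋

ltℕ : ℕ → ℕ → Bool
ltℕ a b = ⌊ a ℕ.<? b ⌋

invCode : (n : ℕ) → Vec ℤ n → ℕ → ℕ
invCode n π i with isOdd n
... | true  = countUpTo (n / 2) λ k →
                ltℕ i (2 ℕ.* k) ∧ ltℤ (w (2 ℕ.* k)) (w i) ∧ ltℤ (w i) (w (suc (2 ℕ.* k)))
  where w = at (toList π)
... | false = countUpTo (n / 2) λ k →
                ltℕ i (2 ℕ.* k ∸ 1) ∧ ltℤ (w (2 ℕ.* k)) (w i) ∧ ltℤ (w i) (w (2 ℕ.* k ∸ 1))
  where w = at (toList π)

-- position (1-indexed) of the entry with absolute value v (0 if none)
posOf : List ℤ → ℕ → ℕ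
posOf xs v = go xs 1
  where
  go : List ℤ → ℕ → ℕ
  go []       _ = 0
  go (x ∷ xs) j = if ⌊ ∣ x ∣ ℕ.≟ v ⌋ then j else go xs (suc j)

-- Φ-steps for k = k₀, …, with r remaining steps; y = current y-coordinate
-- of the endpoint of p₁⋯p_{k-1}; the value handled at step k is n-k+1.
ΦFrom : (n : ℕ) → Vec ℤ n → (r : ℕ) → ℕ → ℤ → Vec (Step × ℤ) r
ΦFrom n π zero    k y = []
ΦFrom n π (suc r) k y =
  let v    = n ∸ k ℕ.+ 1
      i    = posOf (toList π) v
      pos  = ⌊ + 0 ℤ.<? at (toList π) i ⌋          -- πᵢ = v (not v̄)
      up   = if pos then isOdd i else not (isOdd i)
      p    = if up then u else d
      h    = if up then y else y - + 1
      c    = + invCode n π i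
      w    = if pos then c else h - c
      y'   = if up then y ℤ.+ + 1 else y - + 1
  in (p , w) ∷ ΦFrom n π r (suc k) y'

Φ : (n : ℕ) → Vec ℤ n → Vec (Step × ℤ) n
Φ n π = ΦFrom n π n 1 (+ 0)

{-# OPTIONS --safe #-}
module Submission where

-- Let ρᵢ = (−1)^(i−1) πᵢ.  A signed permutation π is a snake iff ρ₁ > 0 and all sums of adjacent
-- entries of ρ are positive, that is, of two adjacent entries the one with larger absolute value
-- is positive.  The k-th step of Φ(π) is u or d according to the sign of the entry ±(n−k+1) of ρ.
--
-- Read the path backwards, placing the values 1, 2, …, n in this order while each maximal run of
-- larger values of constant sign in π is kept as a hole.  Initially there are only holes, one more
-- than the final height of the path; the last hole also contains a virtual entry ∞ at position n+1.
-- A step u replaces a hole other than the last one by the new value, and a step d splits a hole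
-- into two holes separated by the new value.  A step of height h thus offers h+1 holes, and its
-- label tells which one to take: if the hole has sign σ, and c of the holes on offer to its right
-- have the same sign, then the labels c (σ = +) and h − c (σ = −) exhaust 0, …, h without
-- repetition.  Finally c equals the inversion code, because each pair counted there straddles one
-- end of such a hole, and filling the holes later on does not change the number of these pairs.

open import Defs
open import Data.Bool using (Bool; true; false; if_then_else_; not; _∧_)
open import Data.Bool.Properties using (∧-comm; ∧-zeroʳ; ∧-identityʳ; not-involutive)
open import Data.Empty using (⊥)
open import Data.Fin using (Fin; zero; suc)
import Data.Fin.Properties as Fin
open import Data.Integer as ℤ using (ℤ; +_; -[1+_]; ∣_∣)
import Data.Integer.Properties as ℤ
open import Data.List using (List; []; _∷_; _++_; length; drop; downFrom; replicate)
open import Data.List.Membership.Propositional using (_∈_)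
open import Data.List.Properties using (length-drop; length-downFrom; length-++; ++-identityʳ; ∷-injective)
open import Data.List.Membership.Propositional.Properties using (∈-downFrom⁻; ∈-∃++)
open import Data.List.Relation.Binary.Permutation.Propositional
  using (_↭_; ↭⇒↭ₛ; ↭-refl; ↭-sym; ↭-trans; prep; swap)
open import Data.List.Relation.Binary.Permutation.Propositional.Properties
  using (All-resp-↭; shift; ++⁺ʳ; ∈-resp-↭; drop-∷; ↭-length; ↭-empty-inv)
open import Data.List.Relation.Unary.All as All using (All; []; _∷_)
import Data.List.Relation.Unary.All.Properties as All
open import Data.List.Relation.Unary.AllPairs using ([]; _∷_)
open import Data.List.Relation.Unary.Unique.Propositional using (Unique)
open import Data.List.Relation.Unary.Unique.Propositional.Properties using (downFrom⁺)
import Data.List.Relation.Binary.Permutation.Setoid.Properties as Permutationₛ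
open import Data.List.Relation.Unary.Any using (here; there)
open import Data.Nat as ℕ using (ℕ; zero; suc; _+_; _∸_; _≤_; _<_; _≥_; z≤n; s≤s)
open import Data.List.Membership.DecPropositional ℕ._≟_ using (_∈?_)
open import Data.Nat.DivMod using (m≡m%n+[m/n]*n; [m+n]%n≡m%n)
open import Data.Nat.Properties
open import Algebra.Properties.CommutativeSemigroup +-commutativeSemigroup using (x∙yz≈y∙xz)
open import Data.Product using (_×_; _,_; proj₁; proj₂; ∃-syntax)
open import Data.Sum using (_⊎_; inj₁; inj₂)
open import Data.Unit using (⊤; tt)
open import Data.Vec using (Vec; []; _∷_; lookup; toList)
open import Function using (_∘_)
open import Relation.Binary.PropositionalEquality
  using (_≡_; _≢_; refl; sym; trans; cong; cong₂; subst; setoid; module ≡-Reasoning)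
open import Relation.Nullary using (yes; no; contradiction)
open import Relation.Nullary.Decidable using (⌊_⌋; isYes≗does)

-- Holes, signs and insertion

-- Entries of ρ: up v is v+1 and dn v is −(v+1); ∞ is a hole.  The last hole is not recorded: it is
-- the end of the list.
data Tok : Set where
  ∞     : Tok
  up dn : ℕ → Tok

vals : List Tok → List ℕ
vals []         = []
vals (∞ ∷ l)    = vals l
vals (up v ∷ l) = v ∷ vals l
vals (dn v ∷ l) = v ∷ vals l

holes : List Tok → ℕ
holes []         = 0
holes (∞ ∷ l)    = suc (holes l)
holes (up _ ∷ l) = holes l
holes (dn _ ∷ l) = holes l

bit : Bool → ℕ
bit b = if b then 1 else 0

_==_ : Bool → Bool → Bool
true  == b = b
false == b = not b

isHole : Tok → Bool
isHole ∞ = true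
isHole _ = false

-- The last hole can be split by a down step, but not closed by an up step.
endBit : Step → ℕ
endBit u = 0
endBit d = 1

-- Number of holes of sign σ available to a step p, where b is the sign of π in a hole at the first
-- position.
signedHoles : Step → Bool → Bool → List Tok → ℕ
signedHoles p σ b []      = if b == σ then endBit p else 0
signedHoles p σ b (t ∷ l) = bit (isHole t ∧ (b == σ)) + signedHoles p σ (not b) l

-- Ins v p b σ c l l′: the step p places v in a hole of l that has sign σ and c holes of the same
-- sign to its right.
data Ins (v : ℕ) : Step → Bool → Bool → ℕ → List Tok → List Tok → Set where
  close : ∀ {b c l} → c ≡ signedHoles u b (not b) l → Ins v u b b c (∞ ∷ l) (up v ∷ l)
  split : ∀ {b c l} → c ≡ signedHoles d b (not b) l → Ins v d b b c (∞ ∷ l) (∞ ∷ dn v ∷ ∞ ∷ l)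
  end   : ∀ {b} → Ins v d b b 0 [] (∞ ∷ dn v ∷ [])
  skip  : ∀ {p b σ c l l′} t → Ins v p (not b) σ c l l′ → Ins v p b σ c (t ∷ l) (t ∷ l′)

==-refl : ∀ b → (b == b) ≡ true
==-refl true  = refl
==-refl false = refl

==-sound : ∀ b σ → (b == σ) ≡ true → b ≡ σ
==-sound true  true  _ = refl
==-sound false false _ = refl

-- The chosen hole has sign `σ` itself while `c` counts only the holes to its right, hence the
-- strict inequality.
Ins-bound : ∀ {v p b σ c l l′} → Ins v p b σ c l l′ → c < signedHoles p σ b l
Ins-bound {b = b} (close refl) rewrite ==-refl b = ≤-refl
Ins-bound {b = b} (split refl) rewrite ==-refl b = ≤-refl
Ins-bound {b = b} end rewrite ==-refl b = ≤-refl
Ins-bound {b = b} {σ} (skip t i) = ≤-trans (Ins-bound i) (m≤n+m _ (bit (isHole t ∧ (b == σ))))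

Ins-exists : ∀ v p b σ c l → c < signedHoles p σ b l → ∃[ l′ ] Ins v p b σ c l l′
Ins-exists v u b σ c [] c< with b == σ
Ins-exists v u b σ c [] () | true
Ins-exists v u b σ c [] () | false
Ins-exists v d b σ c [] c< with b == σ in eq
Ins-exists v d b σ zero    [] c< | true with refl ← ==-sound b σ eq = _ , end
Ins-exists v d b σ (suc c) [] (s≤s ()) | true
Ins-exists v p b σ c (up w ∷ l) c< with l′ , i ← Ins-exists v p (not b) σ c l c< = _ , skip _ i
Ins-exists v p b σ c (dn w ∷ l) c< with l′ , i ← Ins-exists v p (not b) σ c l c< = _ , skip _ i
Ins-exists v p b σ c (∞ ∷ l) c< with b == σ in eq
... | false with l′ , i ← Ins-exists v p (not b) σ c l c< = _ , skip _ i
... | true with m≤n⇒m<n∨m≡n (≤-pred c<)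
...   | inj₁ c<′ with l′ , i ← Ins-exists v p (not b) σ c l c<′ = _ , skip _ i
Ins-exists v u b σ c (∞ ∷ l) c< | true | inj₂ e with refl ← ==-sound b σ eq = _ , close e
Ins-exists v d b σ c (∞ ∷ l) c< | true | inj₂ e with refl ← ==-sound b σ eq = _ , split e

-- Passing over an available hole of sign `σ` leaves only holes with a strictly smaller count, by
-- `Ins-bound`, so no two holes share sign and count.
Ins-unique : ∀ {v p b σ c l l₁ l₂} → Ins v p b σ c l l₁ → Ins v p b σ c l l₂ → l₁ ≡ l₂
Ins-unique (close _)  (close _)    = refl
Ins-unique (split _)  (split _)    = refl
Ins-unique end        end          = refl
Ins-unique (skip t i) (skip .t j)  = cong (t ∷_) (Ins-unique i j)
Ins-unique (close e)  (skip .∞ j)  = contradiction (sym e) (<⇒≢ (Ins-bound j) ∘ sym)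
Ins-unique (split e)  (skip .∞ j)  = contradiction (sym e) (<⇒≢ (Ins-bound j) ∘ sym)
Ins-unique (skip .∞ i) (close e)   = contradiction (sym e) (<⇒≢ (Ins-bound i) ∘ sym)
Ins-unique (skip .∞ i) (split e)   = contradiction (sym e) (<⇒≢ (Ins-bound i) ∘ sym)

signedHoles-total : ∀ p b l → signedHoles p true b l + signedHoles p false b l ≡ holes l + endBit p
signedHoles-total p true  [] = +-identityʳ (endBit p)
signedHoles-total p false [] = refl
signedHoles-total p true  (∞ ∷ l)    = cong suc (signedHoles-total p false l)
signedHoles-total p false (∞ ∷ l)    = trans (+-suc _ _) (cong suc (signedHoles-total p true l))
signedHoles-total p b     (up _ ∷ l) = signedHoles-total p (not b) l
signedHoles-total p b     (dn _ ∷ l) = signedHoles-total p (not b) l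

Ins-vals : ∀ {v p b σ c l l′} → Ins v p b σ c l l′ → vals l′ ↭ v ∷ vals l
Ins-vals (close _)       = ↭-refl
Ins-vals (split _)       = ↭-refl
Ins-vals end             = ↭-refl
Ins-vals (skip ∞ i)      = Ins-vals i
Ins-vals (skip (up w) i) = ↭-trans (prep w (Ins-vals i)) (swap w _ ↭-refl)
Ins-vals (skip (dn w) i) = ↭-trans (prep w (Ins-vals i)) (swap w _ ↭-refl)

Ins-holes : ∀ {v p b σ c l l′} → Ins v p b σ c l l′ →
  (p ≡ u × holes l ≡ suc (holes l′)) ⊎ (p ≡ d × holes l′ ≡ suc (holes l))
Ins-holes (close _)       = inj₁ (refl , refl)
Ins-holes (split _)       = inj₂ (refl , refl)
Ins-holes end             = inj₂ (refl , refl)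
Ins-holes (skip (up _) i) = Ins-holes i
Ins-holes (skip (dn _) i) = Ins-holes i
Ins-holes (skip ∞ i) with Ins-holes i
... | inj₁ (e , f) = inj₁ (e , cong suc f)
... | inj₂ (e , f) = inj₂ (e , cong suc f)

-- Positivity of the sum of two adjacent entries of ρ, where a hole counts as arbitrarily large.
Adj : Tok → Tok → Set
Adj (up a) (dn b) = b < a
Adj (dn a) (up b) = a < b
Adj (dn _) (dn _) = ⊥
Adj _      _      = ⊤

Ok : Tok → List Tok → Set
Ok t []      = ⊤
Ok t (s ∷ l) = Adj t s × Ok s l

Adj-largest : ∀ {v} t {l} → All (_< v) (vals (t ∷ l)) → Adj t (up v)
Adj-largest ∞      _       = tt
Adj-largest (up _) _       = tt
Adj-largest (dn _) (p ∷ _) = p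

All-vals-tail : ∀ {P : ℕ → Set} t {l} → All P (vals (t ∷ l)) → All P (vals l)
All-vals-tail ∞      p       = p
All-vals-tail (up _) (_ ∷ p) = p
All-vals-tail (dn _) (_ ∷ p) = p

Adj-∞ : ∀ t → Adj t ∞
Adj-∞ ∞      = tt
Adj-∞ (up _) = tt
Adj-∞ (dn _) = tt

Ok-up : ∀ {v} l → All (_< v) (vals l) → Ok ∞ l → Ok (up v) l
Ok-up []         _       _       = tt
Ok-up (∞ ∷ l)    _       o       = o
Ok-up (up w ∷ l) _       o       = o
Ok-up (dn w ∷ l) (p ∷ _) (_ , o) = p , o

-- The new value exceeds those present, so as a peak it fits beside any neighbour; as a valley it
-- has a hole on either side.
Ins-Ok : ∀ {v p b σ c l l′} t → Ins v p b σ c l l′ → Adj t (up v) → All (_< v) (vals l) → Ok t l → Ok t l′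
Ins-Ok t (close _)  s a (_ , o)  = s , Ok-up _ a o
Ins-Ok t (split _)  s a (_ , o)  = Adj-∞ t , tt , tt , o
Ins-Ok t end        s a o        = Adj-∞ t , tt , tt
Ins-Ok t (skip r i) s a (p , o)  = p , Ins-Ok r i (Adj-largest r a) (All-vals-tail r a) o

Ok-∞ : ∀ t l → Ok t l → Ok ∞ l
Ok-∞ t []      _       = tt
Ok-∞ t (s ∷ l) (_ , o) = tt , o

-- A valley `v` arises together with a hole on its left. Excluding it from the head ensures that the
-- search for `v` meets this hole first.
NoHead : ℕ → List Tok → Set
NoHead v (dn w ∷ _) = w ≢ v
NoHead v _          = ⊤

head-dn? : ∀ v l → (∃[ l₁ ] l ≡ dn v ∷ l₁) ⊎ NoHead v l
head-dn? v []         = inj₂ tt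
head-dn? v (∞ ∷ _)    = inj₂ tt
head-dn? v (up _ ∷ _) = inj₂ tt
head-dn? v (dn w ∷ l) with w ℕ.≟ v
... | yes refl = inj₁ (l , refl)
... | no  w≢v  = inj₂ w≢v

NoHead-up : ∀ {v w} → w ≤ v → ∀ l → Ok (up w) l → NoHead v l
NoHead-up w≤ []         _        = tt
NoHead-up w≤ (∞ ∷ _)    _        = tt
NoHead-up w≤ (up _ ∷ _) _        = tt
NoHead-up w≤ (dn x ∷ _) (x< , _) refl = <⇒≱ x< w≤

NoHead-dn : ∀ {v w} l → Ok (dn w) l → NoHead v l
NoHead-dn []         _        = tt
NoHead-dn (∞ ∷ _)    _        = tt
NoHead-dn (up _ ∷ _) _        = tt
NoHead-dn (dn x ∷ _) (() , _)

-- The largest value present is either a peak, which turns into a hole, or a valley, whose two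
-- neighbours must then be holes and fuse with it.
Ins-inverse : ∀ v b t l → Ok t l → All (_≤ v) (vals l) → v ∈ vals l → NoHead v l →
  ∃[ p ] ∃[ σ ] ∃[ c ] ∃[ l₀ ] (Ins v p b σ c l₀ l × Ok t l₀)
Ins-inverse v b t (up w ∷ l) (p , o) (w≤ ∷ a) m h with w ℕ.≟ v
... | yes refl = u , b , _ , _ , close refl , Adj-∞ t , Ok-∞ (up v) l o
Ins-inverse v b t (up w ∷ l) (p , o) (w≤ ∷ a) (here refl) h | no w≢ = contradiction refl w≢
Ins-inverse v b t (up w ∷ l) (p , o) (w≤ ∷ a) (there m) h | no w≢
  with q , σ , c , l₀ , i , o′ ← Ins-inverse v (not b) (up w) l o a m (NoHead-up w≤ l o)
  = q , σ , c , _ , skip _ i , p , o′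
Ins-inverse v b t (dn w ∷ l) (p , o) (w≤ ∷ a) (here refl) h = contradiction refl h
Ins-inverse v b t (dn w ∷ l) (p , o) (w≤ ∷ a) (there m) h
  with q , σ , c , l₀ , i , o′ ← Ins-inverse v (not b) (dn w) l o a m (NoHead-dn l o)
  = q , σ , c , _ , skip _ i , p , o′
Ins-inverse v b t (∞ ∷ l) (p , o) a m h with head-dn? v l
... | inj₂ nh
  with q , σ , c , l₀ , i , o′ ← Ins-inverse v (not b) ∞ l o a m nh
  = q , σ , c , _ , skip _ i , p , o′
Ins-inverse v b t (∞ ∷ _) (p , _ , o) (_ ∷ a) m h | inj₁ ([] , refl) =
  d , b , _ , _ , end , tt
Ins-inverse v b t (∞ ∷ _) (p , _ , _ , o) (_ ∷ a) m h | inj₁ (∞ ∷ l , refl) =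
  d , b , _ , _ , split refl , p , o
Ins-inverse v b t (∞ ∷ _) (p , _ , v<x , o) (_ ∷ x≤ ∷ a) m h | inj₁ (up x ∷ l , refl) =
  contradiction x≤ (<⇒≱ v<x)
Ins-inverse v b t (∞ ∷ _) (p , _ , () , o) (_ ∷ a) m h | inj₁ (dn x ∷ l , refl)

-- Decoding labeled paths

label : Bool → ℕ → ℕ → ℤ
label true  h c = + c
label false h c = + h ℤ.- + c

-- Decodes y s l: reading s backwards, s being the end of a path from height y on, leads to l.
data Decodes : ℕ → List (Step × ℤ) → List Tok → Set where
  done : ∀ {y} → Decodes y [] (replicate y ∞)
  rise : ∀ {y s w σ c l l′} → Decodes (suc y) s l → Ins (length s) u true σ c l l′ →
         w ≡ label σ y c → Decodes y ((u , w) ∷ s) l′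
  fall : ∀ {y s w σ c l l′} → Decodes y s l → Ins (length s) d true σ c l l′ →
         w ≡ label σ y c → Decodes (suc y) ((d , w) ∷ s) l′

[+m]-[+n]≡+[m∸n] : ∀ {m n} → n ≤ m → + m ℤ.- + n ≡ + (m ∸ n)
[+m]-[+n]≡+[m∸n] {m} {n} n≤m = trans (ℤ.[+m]-[+n]≡m⊖n m n) (ℤ.⊖-≥ n≤m)

summand-bound : ∀ {a b h} (σ : Bool) {c} → a + b ≡ suc h → c < (if σ then a else b) → c ≤ h
summand-bound {a} {b} true  e c< = ≤-pred (≤-trans c< (≤-trans (m≤m+n a b) (≤-reflexive e)))
summand-bound {a} {b} false e c< = ≤-pred (≤-trans c< (≤-trans (m≤n+m b a) (≤-reflexive e)))

label-range : ∀ σ {h c} → c ≤ h → (+ 0 ℤ.≤ label σ h c) × (label σ h c ℤ.≤ + h)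
label-range true  c≤h = ℤ.+≤+ z≤n , ℤ.+≤+ c≤h
label-range false {h} {c} c≤h rewrite [+m]-[+n]≡+[m∸n] c≤h = ℤ.+≤+ z≤n , ℤ.+≤+ (m∸n≤m h c)

-- With `a` positive and `b` negative holes, the labels c fill 0, ..., a - 1, and the labels h - c
-- fill a, ..., h because h - (b - 1) = a.
label-surjective : ∀ {a b h m} → a + b ≡ suc h → m ≤ h →
  ∃[ σ ] ∃[ c ] (c < (if σ then a else b) × + m ≡ label σ h c)
label-surjective {a} {b} {h} {m} e m≤h with m ℕ.<? a
... | yes m<a = true , m , m<a , refl
... | no  m≮a = false , h ∸ m , bound , trans (cong +_ (sym (m∸[m∸n]≡n m≤h))) (sym ([+m]-[+n]≡+[m∸n] (m∸n≤m h m)))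
  where
  open ≤-Reasoning
  bound : h ∸ m < b
  bound = begin
    suc (h ∸ m)   ≡⟨ sym (+-∸-assoc 1 m≤h) ⟩
    suc h ∸ m     ≤⟨ ∸-monoʳ-≤ (suc h) (≮⇒≥ m≮a) ⟩
    suc h ∸ a     ≡⟨ cong (_∸ a) (sym e) ⟩
    (a + b) ∸ a   ≡⟨ m+n∸m≡n a b ⟩
    b             ∎

-- Equality would give c + c′ = h, but c + c′ is at most a + b - 2 = h - 1.
label-disjoint : ∀ {a b h c c′} → a + b ≡ suc h → c < a → c′ < b → + c ≢ + h ℤ.- + c′
label-disjoint {a} {b} {h} {c} {c′} e c< c′< eq = 1+n≰n (begin
    suc (suc h)         ≡⟨ cong (λ z → suc (suc z)) (sym (m∸n+n≡m c′≤h)) ⟩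
    suc (suc (h ∸ c′ + c′)) ≡⟨ cong (λ z → suc (suc (z + c′))) (sym (ℤ.+-injective (trans eq ([+m]-[+n]≡+[m∸n] c′≤h)))) ⟩
    suc (suc (c + c′))  ≡⟨ cong suc (sym (+-suc c c′)) ⟩
    suc c + suc c′      ≤⟨ +-mono-≤ c< c′< ⟩
    a + b               ≡⟨ e ⟩
    suc h               ∎)
  where
  open ≤-Reasoning
  c′≤h : c′ ≤ h
  c′≤h = summand-bound {a} {b} false e c′<

label-injective : ∀ {a b h} σ τ {c c′} → a + b ≡ suc h → c < (if σ then a else b) → c′ < (if τ then a else b) →
  label σ h c ≡ label τ h c′ → σ ≡ τ × c ≡ c′
label-injective true true e p q eq = refl , ℤ.+-injective eq
label-injective true false e p q eq = contradiction eq (label-disjoint e p q)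
label-injective false true e p q eq = contradiction (sym eq) (label-disjoint e q p)
label-injective {a} {b} {h} false false {c} {c′} e p q eq = refl , ∸-cancelˡ-≡ c≤ c′≤
    (ℤ.+-injective (trans (sym ([+m]-[+n]≡+[m∸n] c≤)) (trans eq ([+m]-[+n]≡+[m∸n] c′≤))))
  where
  c≤ : c ≤ h
  c≤ = summand-bound {a} {b} false e p
  c′≤ : c′ ≤ h
  c′≤ = summand-bound {a} {b} false e q

holes-replicate : ∀ y → holes (replicate y ∞) ≡ y
holes-replicate zero    = refl
holes-replicate (suc y) = cong suc (holes-replicate y)

vals-replicate : ∀ y → vals (replicate y ∞) ≡ []
vals-replicate zero    = refl
vals-replicate (suc y) = vals-replicate y

Ok-replicate : ∀ y t → Ok t (replicate y ∞)
Ok-replicate zero    t = tt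
Ok-replicate (suc y) t = Adj-∞ t , Ok-replicate y ∞

holes-u : ∀ {v b σ c l l′} → Ins v u b σ c l l′ → holes l ≡ suc (holes l′)
holes-u i with inj₁ (_ , e) ← Ins-holes i = e

holes-d : ∀ {v b σ c l l′} → Ins v d b σ c l l′ → holes l′ ≡ suc (holes l)
holes-d i with inj₂ (_ , e) ← Ins-holes i = e

Decodes-holes : ∀ {y s l} → Decodes y s l → holes l ≡ y
Decodes-holes (done {y})     = holes-replicate y
Decodes-holes (rise x i _) = suc-injective (trans (sym (holes-u i)) (Decodes-holes x))
Decodes-holes (fall x i _) = trans (holes-d i) (cong suc (Decodes-holes x))

Decodes-vals : ∀ {y s l} → Decodes y s l → vals l ↭ downFrom (length s)
Decodes-vals (done {y}) rewrite vals-replicate y = ↭-refl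
Decodes-vals (rise x i _) = ↭-trans (Ins-vals i) (prep _ (Decodes-vals x))
Decodes-vals (fall x i _) = ↭-trans (Ins-vals i) (prep _ (Decodes-vals x))

All-<-downFrom : ∀ {l r} → l ↭ downFrom r → All (_< r) l
All-<-downFrom p = All-resp-↭ (↭-sym p) (All.tabulate ∈-downFrom⁻)

Decodes-< : ∀ {y s l} → Decodes y s l → All (_< length s) (vals l)
Decodes-< x = All-<-downFrom (Decodes-vals x)

-- An initial virtual entry  up 0  forces the word to begin with a peak.
Start : List Tok → Set
Start = Ok (up 0)

Decodes-Start : ∀ {y s l} → Decodes y s l → Start l
Decodes-Start (done {y})   = Ok-replicate y (up 0)
Decodes-Start (rise x i _) = Ins-Ok (up 0) i tt (Decodes-< x) (Decodes-Start x)
Decodes-Start (fall x i _) = Ins-Ok (up 0) i tt (Decodes-< x) (Decodes-Start x)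

-- A step of height y has y + 1 holes on offer: for an up step all are recorded ones, for a down
-- step (`total-d`) there are y recorded ones and the last hole.
total-u : ∀ {l y} → holes l ≡ suc y → signedHoles u true true l + signedHoles u false true l ≡ suc y
total-u {l} e = trans (signedHoles-total u true l) (trans (+-identityʳ _) e)

total-d : ∀ {l y} → holes l ≡ y → signedHoles d true true l + signedHoles d false true l ≡ suc y
total-d {l} e = trans (signedHoles-total d true l) (trans (+-comm _ 1) (cong suc e))

if-signedHoles : ∀ p σ l → signedHoles p σ true l ≡ (if σ then signedHoles p true true l else signedHoles p false true l)
if-signedHoles p true  l = refl
if-signedHoles p false l = refl

Ins-bound′ : ∀ {v p σ c l l′} → Ins v p true σ c l l′ →
  c < (if σ then signedHoles p true true l else signedHoles p false true l)
Ins-bound′ {p = p} {σ} {c} {l} i = subst (c <_) (if-signedHoles p σ l) (Ins-bound i)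

Decodes-exists : ∀ y s → LabeledFrom y s → ∃[ l ] Decodes y s l
Decodes-exists y [] _ = _ , done
Decodes-exists y ((u , + m) ∷ s) (_ , ℤ.+≤+ m≤ , p)
  with l , x ← Decodes-exists (suc y) s p
  with σ , c , c< , e ← label-surjective (total-u {l} (Decodes-holes x)) m≤
  with l′ , i ← Ins-exists (length s) u true σ c l (subst (c <_) (sym (if-signedHoles u σ l)) c<)
  = l′ , rise x i e
Decodes-exists y ((u , -[1+ m ]) ∷ s) (() , _)
Decodes-exists (suc y) ((d , + m) ∷ s) (_ , ℤ.+≤+ m≤ , p)
  with l , x ← Decodes-exists y s p
  with σ , c , c< , e ← label-surjective (total-d {l} (Decodes-holes x)) m≤
  with l′ , i ← Ins-exists (length s) d true σ c l (subst (c <_) (sym (if-signedHoles d σ l)) c<)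
  = l′ , fall x i e
Decodes-exists (suc y) ((d , -[1+ m ]) ∷ s) (() , _)

Decodes-labeled : ∀ {y s l} → Decodes y s l → LabeledFrom y s
Decodes-labeled done = tt
Decodes-labeled (rise {σ = σ} {l = l} x i refl)
  with p , q ← label-range σ (summand-bound σ (total-u {l} (Decodes-holes x)) (Ins-bound′ i))
  = p , q , Decodes-labeled x
Decodes-labeled (fall {σ = σ} {l = l} x i refl)
  with p , q ← label-range σ (summand-bound σ (total-d {l} (Decodes-holes x)) (Ins-bound′ i))
  = p , q , Decodes-labeled x

-- By induction the earlier words agree; the label then determines sign and count, and these
-- determine the hole.
Decodes-unique : ∀ {y s l l′} → Decodes y s l → Decodes y s l′ → l ≡ l′
Decodes-unique done done = refl
Decodes-unique (rise {σ = σ} {l = l} x i e) (rise {σ = τ} x′ i′ e′)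
  with refl ← Decodes-unique x x′
  with refl , refl ← label-injective σ τ (total-u {l} (Decodes-holes x)) (Ins-bound′ i) (Ins-bound′ i′) (trans (sym e) e′)
  = Ins-unique i i′
Decodes-unique (fall {σ = σ} {l = l} x i e) (fall {σ = τ} x′ i′ e′)
  with refl ← Decodes-unique x x′
  with refl , refl ← label-injective σ τ (total-d {l} (Decodes-holes x)) (Ins-bound′ i) (Ins-bound′ i′) (trans (sym e) e′)
  = Ins-unique i i′

vals-[] : ∀ l → vals l ≡ [] → l ≡ replicate (holes l) ∞
vals-[] []      _ = refl
vals-[] (∞ ∷ l) e = cong (∞ ∷_) (vals-[] l e)

Start⇒NoHead : ∀ {v} l → Start l → NoHead v l
Start⇒NoHead []         _ = tt
Start⇒NoHead (∞ ∷ l)    _ = tt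
Start⇒NoHead (up _ ∷ l) _ = tt

-- The largest value must have been placed last. `Ins-inverse` removes it, and sign and count of its
-- hole give the label of the step.
Decodes-complete : ∀ r y l → holes l ≡ y → vals l ↭ downFrom r → Start l → ∃[ s ] (length s ≡ r × Decodes y s l)
Decodes-complete zero y l refl π o =
  [] , refl , subst (Decodes (holes l) []) (sym (vals-[] l (↭-empty-inv π))) done
Decodes-complete (suc r) y l e π o
  with Ins-inverse r true (up 0) l o (All.map ≤-pred (All-<-downFrom π)) (∈-resp-↭ (↭-sym π) (here refl)) (Start⇒NoHead l o)
... | u , σ , c , l₀ , i , o′
  with s , refl , x ← Decodes-complete r (suc y) l₀ (trans (holes-u i) (cong suc e)) (drop-∷ (↭-trans (↭-sym (Ins-vals i)) π)) o′
  = (u , label σ y c) ∷ s , refl , rise x i refl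
-- A down step leaves at least one recorded hole, so height 0 is impossible here.
Decodes-complete (suc r) zero l e π o | d , σ , c , l₀ , i , o′ with () ← trans (sym e) (holes-d i)
Decodes-complete (suc r) (suc y) l e π o | d , σ , c , l₀ , i , o′
  with s , refl , x ← Decodes-complete r y l₀ (suc-injective (trans (sym (holes-d i)) e)) (drop-∷ (↭-trans (↭-sym (Ins-vals i)) π)) o′
  = (d , label σ y c) ∷ s , refl , fall x i refl

-- The inversion code of a word with holes

pairs : ∀ {A : Set} → (A → A → Bool) → List A → ℕ
pairs f (a ∷ b ∷ l) = bit (f a b) + pairs f l
pairs f _           = 0

-- The entry t of ρ is larger than v+1, respectively than −(v+1).
above : ℕ → Tok → Bool
above v ∞      = true
above v (up w) = ltℕ v w
above v (dn w) = false

aboveNeg : ℕ → Tok → Bool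
aboveNeg v ∞      = true
aboveNeg v (up w) = true
aboveNeg v (dn w) = ltℕ w v

-- The conditions a > x and b > -x, where x is v + 1 for `true` and -(v + 1) for `false`.
hit : Bool → ℕ → Tok → Tok → Bool
hit true  v a b = above v a ∧ aboveNeg v b
hit false v a b = aboveNeg v a ∧ above v b

-- π_i lies between π_j and π_{j+1} iff ρ_j > x and ρ_{j+1} > −x for x = (−1)^(j−i) ρ_i; the pairs
-- in question are matched from the right end, so the parity of the suffix l after i determines x.
code : Bool → ℕ → List Tok → ℕ
code s v l = if isOdd (length l) then pairs (hit s v) (drop 1 l) else pairs (hit (not s) v) l

-- Info v b p σ c l: the entry of l with value v yields the step p, has sign σ in π, and has
-- inversion code c.
data Info (v : ℕ) : Bool → Step → Bool → ℕ → List Tok → Set where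
  peak   : ∀ {b σ c l} → σ ≡ b → c ≡ code true v l → Info v b u σ c (up v ∷ l)
  valley : ∀ {b σ c l} → σ ≡ not b → c ≡ code false v l → Info v b d σ c (dn v ∷ l)
  skip   : ∀ {b p σ c l} t → Info v (not b) p σ c l → Info v b p σ c (t ∷ l)

isOdd-suc : ∀ n → isOdd (suc n) ≡ not (isOdd n)
isOdd-suc zero          = refl
isOdd-suc (suc zero)    = refl
isOdd-suc (suc (suc n)) = isOdd-suc n

ltℕ-true : ∀ {a b} → a < b → ltℕ a b ≡ true
ltℕ-true {a} {b} a<b with a ℕ.<? b
... | yes _   = refl
... | no  a≮b = contradiction a<b a≮b

ltℕ-false : ∀ {a b} → b ≤ a → ltℕ a b ≡ false
ltℕ-false {a} {b} b≤a with a ℕ.<? b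
... | yes a<b = contradiction b≤a (<⇒≱ a<b)
... | no  _   = refl

Ins-parity : ∀ {v p b σ c l l′} → Ins v p b σ c l l′ → isOdd (length l′) ≡ isOdd (length l)
Ins-parity (close _) = refl
Ins-parity (split _) = refl
Ins-parity end       = refl
Ins-parity (skip {l = l} {l′} t i) =
  trans (isOdd-suc (length l′)) (trans (cong not (Ins-parity i)) (sym (isOdd-suc (length l))))

module _ {v v′ : ℕ} (v<v′ : v < v′) where

  -- Compared with a smaller value, a peak `v′` looks like a hole, both being above v + 1 and -(v +
  -- 1), whereas a valley `v′` is below both and spoils every pair.
  hit-upˡ : ∀ s t → hit s v (up v′) t ≡ hit s v ∞ t
  hit-upˡ true  t rewrite ltℕ-true v<v′ = refl
  hit-upˡ false t = refl

  hit-upʳ : ∀ s t → hit s v t (up v′) ≡ hit s v t ∞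
  hit-upʳ true  t = refl
  hit-upʳ false t rewrite ltℕ-true v<v′ = refl

  hit-dnˡ : ∀ s t → hit s v (dn v′) t ≡ false
  hit-dnˡ true  t = refl
  hit-dnˡ false t rewrite ltℕ-false (<⇒≤ v<v′) = refl

  hit-dnʳ : ∀ s t → hit s v t (dn v′) ≡ false
  hit-dnʳ true  t rewrite ltℕ-false (<⇒≤ v<v′) = ∧-zeroʳ (above v t)
  hit-dnʳ false t = ∧-zeroʳ (aboveNeg v t)

  -- Closing a hole turns it into a peak, which looks the same to `v`. Splitting creates one more
  -- pair, which contains the valley and does not count, and keeps the alignment of all other pairs.
  pairs-Ins : ∀ {p b σ c l l′} s → Ins v′ p b σ c l l′ → isOdd (length l) ≡ false →
    pairs (hit s v) l′ ≡ pairs (hit s v) l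
  pairs-Ins s (close {l = t ∷ l} _) e rewrite hit-upˡ s t = refl
  pairs-Ins s (split {l = t ∷ l} _) e rewrite hit-dnʳ s ∞ = refl
  pairs-Ins s end e rewrite hit-dnʳ s ∞ = refl
  pairs-Ins s (skip t (close _)) e rewrite hit-upʳ s t = refl
  pairs-Ins s (skip t (split _)) e rewrite hit-dnˡ s ∞ = refl
  pairs-Ins s (skip t (skip t′ i)) e = cong (λ k → bit (hit s v t t′) + k) (pairs-Ins s i e)

  pairs-drop-Ins : ∀ {p b σ c l l′} s → Ins v′ p b σ c l l′ → isOdd (length l) ≡ true →
    pairs (hit s v) (drop 1 l′) ≡ pairs (hit s v) (drop 1 l)
  pairs-drop-Ins s (close _) e = refl
  pairs-drop-Ins s (split _) e rewrite hit-dnˡ s ∞ = refl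
  pairs-drop-Ins s (skip {l = l} t i) e = pairs-Ins s i
    (trans (sym (not-involutive _)) (cong not (trans (sym (isOdd-suc (length l))) e)))

  code-Ins : ∀ {p b σ c l l′} s → Ins v′ p b σ c l l′ → code s v l′ ≡ code s v l
  code-Ins {l = l} s i rewrite Ins-parity i with isOdd (length l) in e
  ... | true  = pairs-drop-Ins s i e
  ... | false = pairs-Ins (not s) i e

  Info-Ins : ∀ {p b σ c l l′ q τ k} → Ins v′ p b σ c l l′ → Info v b q τ k l → Info v b q τ k l′
  Info-Ins (close _)  (skip _ x)   = skip _ x
  -- Two tokens are added in front of the entry, so its sign flag is negated twice.
  Info-Ins {b = b} (split _)  (skip _ x)   = skip _ (skip _ (skip _ (subst (λ b → Info v b _ _ _ _) (sym (not-involutive (not b))) x)))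
  Info-Ins (skip _ i) (peak e f)   = peak e (trans f (sym (code-Ins true i)))
  Info-Ins (skip _ i) (valley e f) = valley e (trans f (sym (code-Ins false i)))
  Info-Ins (skip t i) (skip .t x)  = skip t (Info-Ins i x)

-- The inversion code at the moment of insertion

above-small : ∀ {v} t {l} → All (_< v) (vals (t ∷ l)) → above v t ≡ isHole t
above-small ∞      _       = refl
above-small (up _) (p ∷ _) = ltℕ-false (<⇒≤ p)
above-small (dn _) _       = refl

aboveNeg-small : ∀ {v} t {l} → All (_< v) (vals (t ∷ l)) → aboveNeg v t ≡ true
aboveNeg-small ∞      _       = refl
aboveNeg-small (up _) _       = refl
aboveNeg-small (dn _) (p ∷ _) = ltℕ-true p

==-not : ∀ b → (not b == b) ≡ false
==-not true  = refl
==-not false = refl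

-- When only smaller values are present, `above` recognises exactly the holes and `aboveNeg` always
-- holds. So a pair counts iff a hole occupies a fixed one of its two slots, and the slot fixes the
-- sign.
pairs-holes : ∀ {v} s b l → All (_< v) (vals l) → isOdd (length l) ≡ false →
  pairs (hit s v) l ≡ signedHoles u (b == s) b l
pairs-holes true true [] a e = refl
pairs-holes true false [] a e = refl
pairs-holes false true [] a e = refl
pairs-holes false false [] a e = refl
pairs-holes {v} s b (t ∷ t′ ∷ l) a e with a′ ← All-vals-tail t {t′ ∷ l} a = trans
  (cong₂ _+_ (first s) (trans (pairs-holes s b l (All-vals-tail t′ a′) e) (cong (λ b′ → signedHoles u (b == s) b′ l) (sym (not-involutive b)))))
  (+-assoc (bit (isHole t ∧ (b == (b == s)))) _ _)
  where
  first : ∀ s → bit (hit s v t t′) ≡ bit (isHole t ∧ (b == (b == s))) + bit (isHole t′ ∧ (not b == (b == s)))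
  first true rewrite above-small t {t′ ∷ l} a | aboveNeg-small t′ a′ = lem b (isHole t) (isHole t′)
    where
    lem : ∀ b x y → bit (x ∧ true) ≡ bit (x ∧ (b == (b == true))) + bit (y ∧ (not b == (b == true)))
    lem true x true = sym (+-identityʳ _)
    lem true x false = sym (+-identityʳ _)
    lem false x true = sym (+-identityʳ _)
    lem false x false = sym (+-identityʳ _)
  first false rewrite aboveNeg-small t {t′ ∷ l} a | above-small t′ a′ = lem b (isHole t) (isHole t′)
    where
    lem : ∀ b x y → bit y ≡ bit (x ∧ (b == (b == false))) + bit (y ∧ (not b == (b == false)))
    lem true true y = cong bit (sym (∧-identityʳ y))
    lem true false y = cong bit (sym (∧-identityʳ y))
    lem false true y = cong bit (sym (∧-identityʳ y))
    lem false false y = cong bit (sym (∧-identityʳ y))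

not-false : ∀ {b} → not b ≡ true → b ≡ false
not-false {false} _ = refl

not-true : ∀ {b} → not b ≡ false → b ≡ true
not-true {true} _ = refl

==-flip : ∀ σ b x → (x == not (not b == σ)) ≡ (not x == not (b == σ))
==-flip true  true  true  = refl
==-flip true  true  false = refl
==-flip true  false true  = refl
==-flip true  false false = refl
==-flip false true  true  = refl
==-flip false true  false = refl
==-flip false false true  = refl
==-flip false false false = refl

-- The counts differ by the last hole alone, whose sign is `b` flipped once for each token of `l`.
signedHoles-d : ∀ σ b l →
  signedHoles d σ b l ≡ bit (isOdd (length l) == not (b == σ)) + signedHoles u σ b l
signedHoles-d true  true  [] = refl
signedHoles-d true  false [] = refl
signedHoles-d false true  [] = refl
signedHoles-d false false [] = refl
signedHoles-d σ b (t ∷ l) rewrite isOdd-suc (length l) | signedHoles-d σ (not b) l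
  | ==-flip σ b (isOdd (length l)) =
    x∙yz≈y∙xz (bit (isHole t ∧ (b == σ))) (bit (not (isOdd (length l)) == not (b == σ))) _

signedHoles-d-same : ∀ b l →
  signedHoles d b (not b) l ≡ bit (isOdd (length l)) + signedHoles u b (not b) l
signedHoles-d-same b l rewrite signedHoles-d b (not b) l | ==-not b with isOdd (length l)
... | true  = refl
... | false = refl

==-true : ∀ b → (b == true) ≡ b
==-true true  = refl
==-true false = refl

not-==-false : ∀ b → (not b == false) ≡ b
not-==-false true  = refl
not-==-false false = refl

pairs-true : ∀ {v} b l → All (_< v) (vals l) → isOdd (length l) ≡ false →
  pairs (hit true v) l ≡ signedHoles u b b l
pairs-true b l a e = trans (pairs-holes true b l a e) (cong (λ σ → signedHoles u σ b l) (==-true b))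

pairs-false : ∀ {v} b l → All (_< v) (vals l) → isOdd (length l) ≡ false →
  pairs (hit false v) l ≡ signedHoles u b (not b) l
pairs-false b l a e = trans (pairs-holes false (not b) l a e) (cong (λ σ → signedHoles u σ (not b) l) (not-==-false b))

-- For odd length the dropped token has sign `not b` and would not be counted anyway; in both cases
-- the relevant slot of each pair is the one of sign `b`.
code-peak : ∀ {v} b l → All (_< v) (vals l) → code true v l ≡ signedHoles u b (not b) l
code-peak b l a with isOdd (length l) in e
code-peak b l a       | false = pairs-false b l a e
code-peak b (t ∷ l) a | true
  rewrite ==-not b | ∧-zeroʳ (isHole t) | not-involutive b =
  pairs-true b l (All-vals-tail t a) (not-false (trans (sym (isOdd-suc (length l))) e))

-- Here `∞` is the right half of the split hole. If the suffix has odd length, this half is dropped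
-- and the last hole has the other sign.
code-valley : ∀ {v} b l → All (_< v) (vals l) → code false v (∞ ∷ l) ≡ signedHoles d b (not b) l
code-valley b l a with isOdd (suc (length l)) in e
... | true  rewrite signedHoles-d-same b l | not-false (trans (sym (isOdd-suc (length l))) e) =
  pairs-false b l a (not-false (trans (sym (isOdd-suc (length l))) e))
-- Now the right half is counted, and it makes up for the last hole, which has sign `b` but appears
-- in no pair.
... | false = trans (pairs-true b (∞ ∷ l) a e) (trans
    (cong (λ x → bit x + signedHoles u b (not b) l) (trans (==-refl b) (sym (not-true (trans (sym (isOdd-suc (length l))) e)))))
    (sym (signedHoles-d-same b l)))

Ins-Info : ∀ {v p b σ c l l′} → Ins v p b σ c l l′ → All (_< v) (vals l) → Info v b p σ c l′
Ins-Info {b = b} (close {l = l} e) a = peak refl (trans e (sym (code-peak b l a)))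
Ins-Info {b = b} (split {l = l} e) a = skip ∞ (valley (sym (not-involutive b)) (trans e (sym (code-valley b l a))))
Ins-Info {b = b} end        a = skip ∞ (valley (sym (not-involutive b)) refl)
Ins-Info (skip t i) a = skip t (Ins-Info i (All-vals-tail t a))

-- Comparison with posOf, invCode and Φ

signed : Bool → ℕ → ℤ
signed true  v = + suc v
signed false v = -[1+ v ]

-- The flag is true at odd positions; the junk value + 0 of a hole keeps `encode` invertible.
tokToℤ : Bool → Tok → ℤ
tokToℤ b ∞      = + 0
tokToℤ b (up v) = signed b v
tokToℤ b (dn v) = signed (not b) v

encode : Bool → List Tok → List ℤ
encode b []      = []
encode b (t ∷ l) = tokToℤ b t ∷ encode (not b) l

isU : Step → Bool
isU u = true
isU d = false

flagAt : Bool → ℕ → Bool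
flagAt b zero    = b
flagAt b (suc i) = flagAt (not b) i

position : ℕ → List ℤ → ℕ → ℕ
position v []       j = 0
position v (x ∷ xs) j = if ⌊ ∣ x ∣ ℕ.≟ v ⌋ then j else position v xs (suc j)

-- The local function of `posOf` has no accessible name: `go` is found by unification.
mutual
  go : List ℤ → ℕ → List ℤ → ℕ → ℕ
  go = _

  posOf-position : ∀ v xs → posOf xs v ≡ position v xs 1
  posOf-position v [] = refl
  posOf-position v (x ∷ xs) with ⌊ ∣ x ∣ ℕ.≟ v ⌋
  ... | true = refl
  ... | false with x ∷ xs | 2
  ...   | ys | j = go-position ys v xs j

  go-position : ∀ ys v xs j → go ys v xs j ≡ position v xs j
  go-position ys v []       j = refl
  go-position ys v (x ∷ xs) j rewrite go-position ys v xs (suc j) = refl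

≟-refl : ∀ n → ⌊ n ℕ.≟ n ⌋ ≡ true
≟-refl n with n ℕ.≟ n
... | yes _   = refl
... | no  n≢n = contradiction refl n≢n

≟-≢ : ∀ {m n} → m ≢ n → ⌊ m ℕ.≟ n ⌋ ≡ false
≟-≢ {m} {n} m≢n with m ℕ.≟ n
... | yes m≡n = contradiction m≡n m≢n
... | no  _   = refl

∣signed∣ : ∀ b v → ∣ signed b v ∣ ≡ suc v
∣signed∣ true  v = refl
∣signed∣ false v = refl

Info-∈ : ∀ {v b p σ c l} → Info v b p σ c l → v ∈ vals l
Info-∈ (peak _ _)      = here refl
Info-∈ (valley _ _)    = here refl
Info-∈ (skip ∞ x)      = Info-∈ x
Info-∈ (skip (up _) x) = there (Info-∈ x)
Info-∈ (skip (dn _) x) = there (Info-∈ x)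

Unique-tail : ∀ t {l} → Unique (vals (t ∷ l)) → Unique (vals l)
Unique-tail ∞      q       = q
Unique-tail (up _) (_ ∷ q) = q
Unique-tail (dn _) (_ ∷ q) = q

head-≢ : ∀ {v} b t {l} → v ∈ vals l → Unique (vals (t ∷ l)) → ∣ tokToℤ b t ∣ ≢ suc v
head-≢ b ∞      m q       ()
head-≢ b (up w) m (a ∷ _) e = All.lookup a m (suc-injective (trans (sym (∣signed∣ b w)) e))
head-≢ b (dn w) m (a ∷ _) e = All.lookup a m (suc-injective (trans (sym (∣signed∣ (not b) w)) e))

-- `index` starts from 0, positions in words from 1. The arbitrary start `j` lets `position≡` pass
-- from the tail to the whole word.
record Located (v : ℕ) (b : Bool) (p : Step) (σ : Bool) (c : ℕ) (l : List Tok) : Set where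
  field
    index    : ℕ
    position≡ : ∀ j → position (suc v) (encode b l) j ≡ j + index
    at≡      : at (encode b l) (suc index) ≡ signed σ v
    step≡    : (if σ then flagAt b index else not (flagAt b index)) ≡ isU p
    code≡    : c ≡ code (isU p) v (drop (suc index) l)
    index<   : index < length l

-- The search stops at the first entry with the given absolute value; distinctness of the values
-- excludes an earlier one.
locate : ∀ {v b p σ c l} → Info v b p σ c l → Unique (vals l) → Located v b p σ c l
locate {v} {b} {l = up v ∷ l} (peak refl e) q = record
  { index = 0 ; position≡ = position≡ ; at≡ = refl ; step≡ = step≡ b ; code≡ = e ; index< = s≤s z≤n }
  where
  position≡ : ∀ j → position (suc v) (encode b (up v ∷ l)) j ≡ j + 0
  position≡ j rewrite ∣signed∣ b v | ≟-refl (suc v) = sym (+-identityʳ j)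
  step≡ : ∀ b → (if b then b else not b) ≡ true
  step≡ true  = refl
  step≡ false = refl
locate {v} {b} {l = dn v ∷ l} (valley refl e) q = record
  { index = 0 ; position≡ = position≡ ; at≡ = refl ; step≡ = step≡ b ; code≡ = e ; index< = s≤s z≤n }
  where
  position≡ : ∀ j → position (suc v) (encode b (dn v ∷ l)) j ≡ j + 0
  position≡ j rewrite ∣signed∣ (not b) v | ≟-refl (suc v) = sym (+-identityʳ j)
  step≡ : ∀ b → (if not b then b else not b) ≡ false
  step≡ true  = refl
  step≡ false = refl
locate {v} {b} {l = t ∷ l} (skip t x) q = record
  { index = suc index ; position≡ = position≡′ ; at≡ = at≡ ; step≡ = step≡ ; code≡ = code≡ ; index< = s≤s index< }
  where
  open Located (locate x (Unique-tail t q))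
  position≡′ : ∀ j → position (suc v) (encode b (t ∷ l)) j ≡ j + suc index
  position≡′ j rewrite ≟-≢ (head-≢ b t (Info-∈ x) q) = trans (position≡ (suc j)) (sym (+-suc j index))

flagAt-isOdd : ∀ i → flagAt true i ≡ isOdd (suc i)
flagAt-isOdd zero          = refl
flagAt-isOdd (suc zero)    = refl
flagAt-isOdd (suc (suc i)) = flagAt-isOdd i

-- Inversion codes as counts over consecutive pairs

countUpTo-suc : ∀ m P → countUpTo (suc m) P ≡ bit (P 1) + countUpTo m (P ∘ suc)
countUpTo-suc zero    P = sym (+-identityʳ _)
countUpTo-suc (suc m) P rewrite countUpTo-suc m P = +-assoc (bit (P 1)) _ _

countUpTo-cong : ∀ m {P Q} → (∀ k → P (suc k) ≡ Q (suc k)) → countUpTo m P ≡ countUpTo m Q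
countUpTo-cong zero    e = refl
countUpTo-cong (suc m) e = cong₂ _+_ (countUpTo-cong m e) (cong bit (e m))

-- The pairs (2k - 1, 2k) with i < 2k - 1 make up exactly what remains after the first `roundUp i`
-- letters.
roundUp : ℕ → ℕ
roundUp zero          = 0
roundUp (suc zero)    = 2
roundUp (suc (suc i)) = suc (suc (roundUp i))

pairAt : (ℤ → ℤ → Bool) → ℕ → List ℤ → ℕ → Bool
pairAt f i xs j = ltℕ i (j ∸ 1) ∧ f (at xs (j ∸ 1)) (at xs j)

ltℕ-suc : ∀ a b → ltℕ (suc a) (suc b) ≡ ltℕ a b
ltℕ-suc a b = trans (isYes≗does (suc a ℕ.<? suc b)) (sym (isYes≗does (a ℕ.<? b)))

ltℕ-∸2 : ∀ i j → ltℕ i (suc (suc (suc j))) ≡ ltℕ (i ∸ 2) (suc j)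
ltℕ-∸2 zero          j = refl
ltℕ-∸2 (suc zero)    j = trans (ltℕ-suc 0 (suc (suc j))) refl
ltℕ-∸2 (suc (suc i)) j = trans (ltℕ-suc (suc i) (suc (suc j))) (ltℕ-suc i (suc j))

drop-[] : ∀ {A : Set} k → drop {A = A} k [] ≡ []
drop-[] zero    = refl
drop-[] (suc k) = refl

-- Removing the first pair lowers all positions by 2. Truncation in `i ∸ 2` is harmless, since for i
-- ≤ 2 every later pair lies beyond i.
countUpTo-pairs : ∀ f m i xs → length xs ≡ 2 ℕ.* m →
  countUpTo m (λ k → pairAt f i xs (2 ℕ.* k)) ≡ pairs f (drop (roundUp i) xs)
countUpTo-pairs f zero i [] e rewrite drop-[] {ℤ} (roundUp i) = refl
countUpTo-pairs f (suc m) i (x ∷ []) e with () ← trans e (*-suc 2 m)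
countUpTo-pairs f (suc m) i (x ∷ y ∷ xs) e = begin
    countUpTo (suc m) (λ k → pairAt f i (x ∷ y ∷ xs) (2 ℕ.* k))
      ≡⟨ countUpTo-suc m (λ k → pairAt f i (x ∷ y ∷ xs) (2 ℕ.* k)) ⟩
    bit (ltℕ i 1 ∧ f x y) + countUpTo m (λ k → pairAt f i (x ∷ y ∷ xs) (2 ℕ.* suc k))
      ≡⟨ cong (λ z → bit (ltℕ i 1 ∧ f x y) + z) (countUpTo-cong m shifted) ⟩
    bit (ltℕ i 1 ∧ f x y) + countUpTo m (λ k → pairAt f (i ∸ 2) xs (2 ℕ.* k))
      ≡⟨ cong (λ z → bit (ltℕ i 1 ∧ f x y) + z) (countUpTo-pairs f m (i ∸ 2) xs len) ⟩
    bit (ltℕ i 1 ∧ f x y) + pairs f (drop (roundUp (i ∸ 2)) xs)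
      ≡⟨ last i ⟩
    pairs f (drop (roundUp i) (x ∷ y ∷ xs)) ∎
  where
  open ≡-Reasoning
  len : length xs ≡ 2 ℕ.* m
  len = suc-injective (suc-injective (trans e (*-suc 2 m)))
  shifted : ∀ k → pairAt f i (x ∷ y ∷ xs) (2 ℕ.* suc (suc k)) ≡ pairAt f (i ∸ 2) xs (2 ℕ.* suc k)
  shifted k = begin
    pairAt f i (x ∷ y ∷ xs) (2 ℕ.* suc (suc k))
      ≡⟨ cong (pairAt f i (x ∷ y ∷ xs)) (trans (*-suc 2 (suc k)) (cong (λ z → suc (suc z)) (*-suc 2 k))) ⟩
    pairAt f i (x ∷ y ∷ xs) (4 + 2 ℕ.* k)
      ≡⟨ cong (_∧ f (at xs (1 + 2 ℕ.* k)) (at xs (2 + 2 ℕ.* k))) (ltℕ-∸2 i (2 ℕ.* k)) ⟩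
    pairAt f (i ∸ 2) xs (2 + 2 ℕ.* k)
      ≡⟨ cong (pairAt f (i ∸ 2) xs) (sym (*-suc 2 k)) ⟩
    pairAt f (i ∸ 2) xs (2 ℕ.* suc k) ∎
  -- The first pair counts only for i = 0, a case that comes from the first entry of a word of odd
  -- length.
  last : ∀ i → bit (ltℕ i 1 ∧ f x y) + pairs f (drop (roundUp (i ∸ 2)) xs) ≡ pairs f (drop (roundUp i) (x ∷ y ∷ xs))
  last zero          = refl
  last (suc zero)    = refl
  last (suc (suc i)) = refl

isOdd-half : ∀ n → n ≡ bit (isOdd n) + 2 ℕ.* (n ℕ./ 2)
isOdd-half n = trans (m≡m%n+[m/n]*n n 2) (cong₂ _+_ (lem n) (*-comm (n ℕ./ 2) 2))
  where
  lem : ∀ n → n ℕ.% 2 ≡ bit (isOdd n)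
  lem zero          = refl
  lem (suc zero)    = refl
  lem (suc (suc n)) = trans (trans (cong (ℕ._% 2) (+-comm 2 n)) ([m+n]%n≡m%n n 2)) (lem n)

evenPair oddPair : ℤ → ℤ → ℤ → Bool
evenPair z a b = ltℤ b z ∧ ltℤ z a
oddPair  z a b = ltℤ a z ∧ ltℤ z b

invCode-even : ∀ n (π : Vec ℤ n) i → isOdd n ≡ false → length (toList π) ≡ n →
  invCode n π i ≡ pairs (evenPair (at (toList π) i)) (drop (roundUp i) (toList π))
invCode-even n π i e len with isOdd n | isOdd-half n
invCode-even n π i refl len | false | half =
  countUpTo-pairs (evenPair (at (toList π) i)) (n ℕ./ 2) i (toList π) (trans len half)

-- Without the first letter, the pairs (2k, 2k + 1) become (2k - 1, 2k) and all positions drop by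
-- one, which is why the position is `suc i`.
invCode-odd : ∀ n (π : Vec ℤ n) i → isOdd n ≡ true → length (toList π) ≡ n →
  invCode n π (suc i) ≡ pairs (oddPair (at (toList π) (suc i))) (drop (suc (roundUp i)) (toList π))
invCode-odd n π i e len with isOdd n | isOdd-half n
invCode-odd n (x ∷ π) i refl len | true | half = trans
  (countUpTo-cong (n ℕ./ 2) shifted)
  (countUpTo-pairs f (n ℕ./ 2) i (toList π) (suc-injective (trans len half)))
  where
  f : ℤ → ℤ → Bool
  f = oddPair (at (x ∷ toList π) (suc i))
  g : ℕ → Bool
  g j = ltℕ (suc i) j ∧ f (at (x ∷ toList π) j) (at (x ∷ toList π) (suc j))
  shifted : ∀ k → g (2 ℕ.* suc k) ≡ pairAt f i (toList π) (2 ℕ.* suc k)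
  shifted k = trans (cong g (*-suc 2 k)) (trans
    (cong (_∧ f (at (toList π) (1 + 2 ℕ.* k)) (at (toList π) (2 + 2 ℕ.* k))) (ltℕ-suc i (1 + 2 ℕ.* k)))
    (cong (pairAt f i (toList π)) (sym (*-suc 2 k))))

drop-encode : ∀ b k l → drop k (encode b l) ≡ encode (flagAt b k) (drop k l)
drop-encode b zero    l       = refl
drop-encode b (suc k) []      = refl
drop-encode b (suc k) (t ∷ l) = drop-encode (not b) k l

ltℤ-+ : ∀ a b → ltℤ (+ suc a) (+ suc b) ≡ ltℕ a b
ltℤ-+ a b = trans (isYes≗does (+ suc a ℤ.<? + suc b)) (sym (isYes≗does (a ℕ.<? b)))

ltℤ-- : ∀ a b → ltℤ -[1+ a ] -[1+ b ] ≡ ltℕ b a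
ltℤ-- a b = trans (isYes≗does (-[1+ a ] ℤ.<? -[1+ b ])) (sym (isYes≗does (b ℕ.<? a)))

ltℤ-signed-tok : ∀ σ v t → isHole t ≡ false →
  ltℤ (signed σ v) (tokToℤ true t) ≡ (if σ then above v t else aboveNeg v t)
ltℤ-signed-tok true  v (up w) _ = ltℤ-+ v w
ltℤ-signed-tok true  v (dn w) _ = refl
ltℤ-signed-tok false v (up w) _ = refl
ltℤ-signed-tok false v (dn w) _ = ltℤ-- v w

ltℤ-tok-signed : ∀ σ v t → isHole t ≡ false →
  ltℤ (tokToℤ false t) (signed σ v) ≡ (if σ then aboveNeg v t else above v t)
ltℤ-tok-signed true  v (up w) _ = refl
ltℤ-tok-signed true  v (dn w) _ = ltℤ-+ w v
ltℤ-tok-signed false v (up w) _ = ltℤ-- w v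
ltℤ-tok-signed false v (dn w) _ = refl

-- Since ρ is π at odd and -π at even positions, b < z < a in π reads a > z and b > -z in ρ. For
-- `oddPair` the first position is even, which replaces z by -z.
evenPair-hit : ∀ σ v a b → isHole a ≡ false → isHole b ≡ false →
  evenPair (signed σ v) (tokToℤ true a) (tokToℤ false b) ≡ hit σ v a b
evenPair-hit true  v a b p q rewrite ltℤ-tok-signed true  v b q | ltℤ-signed-tok true  v a p = ∧-comm (aboveNeg v b) (above v a)
evenPair-hit false v a b p q rewrite ltℤ-tok-signed false v b q | ltℤ-signed-tok false v a p = ∧-comm (above v b) (aboveNeg v a)

oddPair-hit : ∀ σ v a b → isHole a ≡ false → isHole b ≡ false →
  oddPair (signed σ v) (tokToℤ false a) (tokToℤ true b) ≡ hit (not σ) v a b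
oddPair-hit true  v a b p q rewrite ltℤ-tok-signed true  v a p | ltℤ-signed-tok true  v b q = refl
oddPair-hit false v a b p q rewrite ltℤ-tok-signed false v a p | ltℤ-signed-tok false v b q = refl

HoleFree : List Tok → Set
HoleFree = All (λ t → isHole t ≡ false)

pairs-encode : ∀ {f g} b l → HoleFree l →
  (∀ s t → isHole s ≡ false → isHole t ≡ false → f (tokToℤ b s) (tokToℤ (not b) t) ≡ g s t) →
  pairs f (encode b l) ≡ pairs g l
pairs-encode b []           _           e = refl
pairs-encode b (s ∷ [])     _           e = refl
pairs-encode {f} b (s ∷ t ∷ l) (p ∷ q ∷ a) e rewrite e s t p q | not-involutive b =
  cong (λ k → _ + k) (pairs-encode b l a e)

isOdd-∸ : ∀ {k n} → k ≤ n → isOdd (n ∸ k) ≡ not (isOdd n == isOdd k)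
isOdd-∸ {zero} {n} _ with isOdd n
... | true  = refl
... | false = refl
isOdd-∸ {suc k} {suc n} (s≤s k≤n) rewrite isOdd-suc n | isOdd-suc k | isOdd-∸ k≤n with isOdd n | isOdd k
... | true  | x = cong not (sym (not-involutive x))
... | false | x = refl

isOdd-length-drop : ∀ k (l : List Tok) → k ≤ length l → isOdd (length (drop k l)) ≡ not (isOdd (length l) == isOdd k)
isOdd-length-drop k l k≤ = trans (cong isOdd (length-drop k l)) (isOdd-∸ k≤)

roundUp-odd : ∀ k → isOdd k ≡ true → roundUp k ≡ suc k
roundUp-odd (suc zero)    _ = refl
roundUp-odd (suc (suc k)) e = cong (λ m → suc (suc m)) (roundUp-odd k e)

roundUp-even : ∀ k → isOdd k ≡ false → roundUp k ≡ k
roundUp-even zero          _ = refl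
roundUp-even (suc (suc k)) e = cong (λ m → suc (suc m)) (roundUp-even k e)

drop-suc : ∀ {A : Set} k (l : List A) → drop (suc k) l ≡ drop 1 (drop k l)
drop-suc zero    l       = refl
drop-suc (suc k) []      = refl
drop-suc (suc k) (x ∷ l) = drop-suc k l

flagAt-roundUp : ∀ b k → flagAt b (roundUp k) ≡ b
flagAt-roundUp b zero          = refl
flagAt-roundUp b (suc zero)    = not-involutive b
flagAt-roundUp b (suc (suc k)) = trans (flagAt-roundUp (not (not b)) k) (not-involutive b)

code-odd : ∀ s v l → isOdd (length l) ≡ true → code s v l ≡ pairs (hit s v) (drop 1 l)
code-odd s v l e rewrite e = refl

code-even : ∀ s v l → isOdd (length l) ≡ false → code s v l ≡ pairs (hit (not s) v) l
code-even s v l e rewrite e = refl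

pairs-encode-drop : ∀ {f g} b k l → HoleFree l →
  (∀ s t → isHole s ≡ false → isHole t ≡ false → f (tokToℤ b s) (tokToℤ (not b) t) ≡ g s t) →
  flagAt true k ≡ b → pairs f (drop k (encode true l)) ≡ pairs g (drop k l)
pairs-encode-drop b k l h e refl rewrite drop-encode true k l =
  pairs-encode (flagAt true k) (drop k l) (All.drop⁺ k h) e

invCode-even-hit : ∀ n (π : Vec ℤ n) l i σ v → toList π ≡ encode true l → length (toList π) ≡ n → HoleFree l →
  at (toList π) i ≡ signed σ v → isOdd n ≡ false → invCode n π i ≡ pairs (hit σ v) (drop (roundUp i) l)
invCode-even-hit n π l i σ v eq len h z o = trans (invCode-even n π i o len)
  (trans (cong₂ (λ z xs → pairs (evenPair z) (drop (roundUp i) xs)) z eq)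
    (pairs-encode-drop true (roundUp i) l h (evenPair-hit σ v) (flagAt-roundUp true i)))

invCode-odd-hit : ∀ n (π : Vec ℤ n) l i σ v → toList π ≡ encode true l → length (toList π) ≡ n → HoleFree l →
  at (toList π) (suc i) ≡ signed σ v → isOdd n ≡ true → invCode n π (suc i) ≡ pairs (hit (not σ) v) (drop (suc (roundUp i)) l)
invCode-odd-hit n π l i σ v eq len h z o = trans (invCode-odd n π i o len)
  (trans (cong₂ (λ z xs → pairs (oddPair z) (drop (suc (roundUp i)) xs)) z eq)
    (pairs-encode-drop false (suc (roundUp i)) l h (oddPair-hit σ v) (flagAt-roundUp false i)))

if-true : ∀ σ → (if σ then true else not true) ≡ σ
if-true true  = refl
if-true false = refl

if-false : ∀ σ → (if σ then false else not false) ≡ not σ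
if-false true  = refl
if-false false = refl

module _ (n : ℕ) (π : Vec ℤ n) (l : List Tok) (i : ℕ) (σ : Bool) (v : ℕ)
         (eq : toList π ≡ encode true l) (len : length (toList π) ≡ n) (len′ : length l ≡ n)
         (h : HoleFree l) (i< : i < length l) (z : at (toList π) (suc i) ≡ signed σ v) where

  private
    suffix-parity : ∀ {x y} → isOdd n ≡ x → isOdd (suc i) ≡ y → isOdd (length (drop (suc i) l)) ≡ not (x == y)
    suffix-parity refl refl rewrite sym len′ = isOdd-length-drop (suc i) l i<

  -- The flag of `code` is the sign of ρ at this position. If n and the position differ in parity,
  -- the entry is the first of a pair and its partner is the letter that `code` drops; otherwise the
  -- pairs begin right after the entry.
  invCode-code : ∀ x y → isOdd n ≡ x → isOdd (suc i) ≡ y →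
    invCode n π (suc i) ≡ code (if σ then y else not y) v (drop (suc i) l)
  invCode-code false true on oi rewrite if-true σ =
    trans (invCode-even-hit n π l (suc i) σ v eq len h z on)
    (trans (cong (pairs (hit σ v)) (trans (cong (λ k → drop k l) (roundUp-odd (suc i) oi)) (drop-suc (suc i) l)))
     (sym (code-odd σ v (drop (suc i) l) (suffix-parity on oi))))
  invCode-code false false on oi rewrite if-false σ =
    trans (invCode-even-hit n π l (suc i) σ v eq len h z on)
    (trans (cong₂ (λ σ k → pairs (hit σ v) (drop k l)) (sym (not-involutive σ)) (roundUp-even (suc i) oi))
     (sym (code-even (not σ) v (drop (suc i) l) (suffix-parity on oi))))
  invCode-code true true on oi rewrite if-true σ =
    trans (invCode-odd-hit n π l i σ v eq len h z on)
    (trans (cong (λ k → pairs (hit (not σ) v) (drop (suc k) l)) (roundUp-even i (not-false (trans (sym (isOdd-suc i)) oi))))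
     (sym (code-even σ v (drop (suc i) l) (suffix-parity on oi))))
  invCode-code true false on oi rewrite if-false σ =
    trans (invCode-odd-hit n π l i σ v eq len h z on)
    (trans (cong (pairs (hit (not σ) v)) (trans (cong (λ k → drop (suc k) l) (roundUp-odd i (not-true (trans (sym (isOdd-suc i)) oi)))) (drop-suc (suc i) l)))
     (sym (code-odd (not σ) v (drop (suc i) l) (suffix-parity on oi))))

signed-positive : ∀ σ v → ⌊ + 0 ℤ.<? signed σ v ⌋ ≡ σ
signed-positive true  v = refl
signed-positive false v = refl

-- The body of `ΦFrom` with sign, parity and inversion code as arguments, so that each can be
-- replaced by its value.
ΦStep : ∀ {r} → Bool → Bool → ℕ → ℤ → (ℤ → Vec (Step × ℤ) r) → Vec (Step × ℤ) (suc r)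
ΦStep pos odd c y rest =
  let up = if pos then odd else not odd
      h  = if up then y else y ℤ.- + 1
  in ((if up then u else d) , (if pos then + c else h ℤ.- + c)) ∷ rest (if up then y ℤ.+ + 1 else y ℤ.- + 1)

ΦStep-u : ∀ {r} σ odd c y (rest : ℤ → Vec (Step × ℤ) r) → (if σ then odd else not odd) ≡ true →
  ΦStep σ odd c (+ y) rest ≡ (u , label σ y c) ∷ rest (+ suc y)
ΦStep-u true  odd c y rest refl rewrite +-comm y 1 = refl
ΦStep-u false odd c y rest e rewrite e | +-comm y 1 = refl

ΦStep-d : ∀ {r} σ odd c y (rest : ℤ → Vec (Step × ℤ) r) → (if σ then odd else not odd) ≡ false →
  ΦStep σ odd c (+ suc y) rest ≡ (d , label σ y c) ∷ rest (+ y)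
ΦStep-d true  odd c y rest refl = refl
ΦStep-d false odd c y rest e rewrite e = refl

level-value : ∀ {n} r k → k + suc r ≡ suc n → n ∸ k + 1 ≡ suc r
level-value {n} r k e rewrite sym (suc-injective (trans (sym (+-suc k r)) e)) | m+n∸m≡n k r = +-comm r 1

module _ (n : ℕ) (π : Vec ℤ n) (l : List Tok) (eq : toList π ≡ encode true l)
         (len : length (toList π) ≡ n) (len′ : length l ≡ n) (h : HoleFree l) (uniq : Unique (vals l)) where

  ΦFrom-suc : ∀ {v p σ c} r k y → Info v true p σ c l → n ∸ k + 1 ≡ suc v →
    ∃[ odd ] ((if σ then odd else not odd) ≡ isU p × ΦFrom n π (suc r) k y ≡ ΦStep σ odd c y (ΦFrom n π r (suc k)))
  ΦFrom-suc {v} {p} {σ} {c} r k y x nk = isOdd (suc index) , step , trans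
      (cong (λ i → ΦStep ⌊ + 0 ℤ.<? at (toList π) i ⌋ (isOdd i) (invCode n π i) y (ΦFrom n π r (suc k))) pos≡)
      (cong₂ (λ σ c → ΦStep σ (isOdd (suc index)) c y (ΦFrom n π r (suc k)))
        (trans (cong (λ z → ⌊ + 0 ℤ.<? z ⌋) at≡′) (signed-positive σ v))
        (trans (invCode-code n π l index σ v eq len len′ h index< at≡′ _ _ refl refl)
               (trans (cong (λ s → code s v (drop (suc index) l)) step) (sym code≡))))
    where
    open Located (locate x uniq)
    pos≡ : posOf (toList π) (n ∸ k + 1) ≡ suc index
    pos≡ = trans (cong₂ posOf eq nk) (trans (posOf-position (suc v) (encode true l)) (position≡ 1))
    at≡′ : at (toList π) (suc index) ≡ signed σ v
    at≡′ = trans (cong (λ xs → at xs (suc index)) eq) at≡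
    step : (if σ then isOdd (suc index) else not (isOdd (suc index))) ≡ isU p
    step = trans (cong (λ f → if σ then f else not f) (sym (flagAt-isOdd index))) step≡

  -- Φ treats the values from the largest down, undoing the insertions in turn. Each value is read
  -- off from the word in which it was largest (`Ins-Info`), and `keep` transports this through the
  -- later insertions to the full word `l`.
  Decodes-ΦFrom : ∀ {y s l₀} r k → Decodes y s l₀ → length s ≡ r → k + r ≡ suc n →
    (∀ {v q τ c} → v < r → Info v true q τ c l₀ → Info v true q τ c l) →
    toList (ΦFrom n π r k (+ y)) ≡ s
  Decodes-ΦFrom _ k done refl _ _ = refl
  Decodes-ΦFrom (suc r) k (rise {y} {σ = σ} {c} x i refl) refl kr keep
    with odd , e , f ← ΦFrom-suc r k (+ y) (keep ≤-refl (Ins-Info i (Decodes-< x))) (level-value r k kr)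
    = trans (cong toList (trans f (ΦStep-u σ odd c y (ΦFrom n π r (suc k)) e)))
        (cong (_ ∷_) (Decodes-ΦFrom r (suc k) x refl (trans (sym (+-suc k r)) kr)
          (λ v< z → keep (m<n⇒m<1+n v<) (Info-Ins v< i z))))
  Decodes-ΦFrom (suc r) k (fall {y} {σ = σ} {c} x i refl) refl kr keep
    with odd , e , f ← ΦFrom-suc r k (+ suc y) (keep ≤-refl (Ins-Info i (Decodes-< x))) (level-value r k kr)
    = trans (cong toList (trans f (ΦStep-d σ odd c y (ΦFrom n π r (suc k)) e)))
        (cong (_ ∷_) (Decodes-ΦFrom r (suc k) x refl (trans (sym (+-suc k r)) kr)
          (λ v< z → keep (m<n⇒m<1+n v<) (Info-Ins v< i z))))

  Decodes-Φ : ∀ {s} → Decodes 0 s l → length s ≡ n → toList (Φ n π) ≡ s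
  Decodes-Φ x e = Decodes-ΦFrom n 1 x e refl (λ _ z → z)

-- Snakes as words without holes

length-toList : ∀ {A : Set} {n} (xs : Vec A n) → length (toList xs) ≡ n
length-toList []       = refl
length-toList (x ∷ xs) = cong suc (length-toList xs)

toList-injective : ∀ {A : Set} {n} (xs ys : Vec A n) → toList xs ≡ toList ys → xs ≡ ys
toList-injective []       []       e = refl
toList-injective (x ∷ xs) (y ∷ ys) e with p , q ← ∷-injective e = cong₂ _∷_ p (toList-injective xs ys q)

toList-surjective : ∀ {A : Set} {n} (xs : List A) → length xs ≡ n → ∃[ ys ] toList {A = A} {n} ys ≡ xs
toList-surjective []       refl = [] , refl
toList-surjective (x ∷ xs) refl with ys , e ← toList-surjective xs refl = x ∷ ys , cong (x ∷_) e

length-encode : ∀ b l → length (encode b l) ≡ length l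
length-encode b []      = refl
length-encode b (t ∷ l) = cong suc (length-encode (not b) l)

ℤToTok : Bool → ℤ → Tok
ℤToTok b     (+ zero)   = ∞
ℤToTok true  (+ suc v)  = up v
ℤToTok true  -[1+ v ]   = dn v
ℤToTok false (+ suc v)  = dn v
ℤToTok false -[1+ v ]   = up v

decode : Bool → List ℤ → List Tok
decode b []       = []
decode b (x ∷ xs) = ℤToTok b x ∷ decode (not b) xs

tokToℤ-ℤToTok : ∀ b x → tokToℤ b (ℤToTok b x) ≡ x
tokToℤ-ℤToTok b     (+ zero)  = refl
tokToℤ-ℤToTok true  (+ suc v) = refl
tokToℤ-ℤToTok true  -[1+ v ]  = refl
tokToℤ-ℤToTok false (+ suc v) = refl
tokToℤ-ℤToTok false -[1+ v ]  = refl

encode-decode : ∀ b xs → encode b (decode b xs) ≡ xs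
encode-decode b []       = refl
encode-decode b (x ∷ xs) = cong₂ _∷_ (tokToℤ-ℤToTok b x) (encode-decode (not b) xs)

holes≡0⇒HoleFree : ∀ l → holes l ≡ 0 → HoleFree l
holes≡0⇒HoleFree []         _ = []
holes≡0⇒HoleFree (up _ ∷ l) e = refl ∷ holes≡0⇒HoleFree l e
holes≡0⇒HoleFree (dn _ ∷ l) e = refl ∷ holes≡0⇒HoleFree l e

HoleFree⇒holes≡0 : ∀ {l} → HoleFree l → holes l ≡ 0
HoleFree⇒holes≡0 []                       = refl
HoleFree⇒holes≡0 (_∷_ {x = up _} _ h)     = HoleFree⇒holes≡0 h
HoleFree⇒holes≡0 (_∷_ {x = dn _} _ h)     = HoleFree⇒holes≡0 h

length-vals : ∀ {l} → HoleFree l → length (vals l) ≡ length l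
length-vals []                   = refl
length-vals (_∷_ {x = up _} _ h) = cong suc (length-vals h)
length-vals (_∷_ {x = dn _} _ h) = cong suc (length-vals h)

-- Signed permutations as lists of distinct values

Unique-resp-↭ : ∀ {xs ys : List ℕ} → xs ↭ ys → Unique xs → Unique ys
Unique-resp-↭ p = Permutationₛ.Unique-resp-↭ (setoid ℕ) (↭⇒↭ₛ p)

-- Carrying along the missing values `ys` allows induction on `n` without control of the length; in
-- `Unique⇒↭downFrom` the length then forces `ys` to be empty.
Unique-complete : ∀ n xs → Unique xs → All (_< n) xs → ∃[ ys ] xs ++ ys ↭ downFrom n
Unique-complete zero    []      _ _        = [] , ↭-refl
Unique-complete zero    (x ∷ _) _ (() ∷ _)
Unique-complete (suc n) xs q a with n ∈? xs
... | no n∉xs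
  with ys , p ← Unique-complete n xs q (All.tabulate (λ {x} x∈ → ≤∧≢⇒< (≤-pred (All.lookup a x∈)) (λ { refl → n∉xs x∈ })))
  = n ∷ ys , ↭-trans (shift n xs ys) (prep n p)
... | yes n∈xs
  with ps , qs , refl ← ∈-∃++ n∈xs
  with n≢ ∷ q′ ← Unique-resp-↭ (shift n ps qs) q
  with _ ∷ a′ ← All-resp-↭ (shift n ps qs) a
  with ys , p ← Unique-complete n (ps ++ qs) q′ (All.zipWith (λ { (x< , n≢x) → ≤∧≢⇒< (≤-pred x<) (n≢x ∘ sym) }) (a′ , n≢))
  = ys , ↭-trans (++⁺ʳ ys (shift n ps qs)) (prep n p)

Unique⇒↭downFrom : ∀ n xs → Unique xs → All (_< n) xs → length xs ≡ n → xs ↭ downFrom n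
Unique⇒↭downFrom n xs q a e with Unique-complete n xs q a
... | [] , p = subst (_↭ downFrom n) (++-identityʳ xs) p
... | y ∷ ys , p = contradiction (trans (sym (length-++ xs)) (trans (↭-length p) (trans (length-downFrom n) (sym e))))
                     (λ f → 1+n≰n (≤-trans (m≤m+n (suc (length xs)) (length ys)) (≤-reflexive (trans (sym (+-suc (length xs) (length ys))) f))))

All-vals : ∀ {P : ℕ → Set} {m} (π : Vec ℤ m) b l → toList π ≡ encode b l →
  (∀ i v → ∣ lookup π i ∣ ≡ suc v → P v) → All P (vals l)
All-vals π b [] e f = []
All-vals (x ∷ π) b (∞ ∷ l) e f = All-vals π (not b) l (proj₂ (∷-injective e)) (f ∘ suc)
All-vals (x ∷ π) b (up v ∷ l) e f with refl , e′ ← ∷-injective e =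
  f zero v (∣signed∣ b v) ∷ All-vals π (not b) l e′ (f ∘ suc)
All-vals (x ∷ π) b (dn v ∷ l) e f with refl , e′ ← ∷-injective e =
  f zero v (∣signed∣ (not b) v) ∷ All-vals π (not b) l e′ (f ∘ suc)

nonzero⇒HoleFree : ∀ {m} (π : Vec ℤ m) b l → toList π ≡ encode b l → (∀ i → 1 ≤ ∣ lookup π i ∣) → HoleFree l
nonzero⇒HoleFree π       b []         e f = []
nonzero⇒HoleFree (x ∷ π) b (∞ ∷ l)    e f with refl , _ ← ∷-injective e with () ← f zero
nonzero⇒HoleFree (x ∷ π) b (up v ∷ l) e f = refl ∷ nonzero⇒HoleFree π (not b) l (proj₂ (∷-injective e)) (f ∘ suc)
nonzero⇒HoleFree (x ∷ π) b (dn v ∷ l) e f = refl ∷ nonzero⇒HoleFree π (not b) l (proj₂ (∷-injective e)) (f ∘ suc)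

InjectiveAbs : ∀ {m} → Vec ℤ m → Set
InjectiveAbs {m} π = ∀ (i j : Fin m) → ∣ lookup π i ∣ ≡ ∣ lookup π j ∣ → i ≡ j

InjectiveAbs-tail : ∀ {m x} {π : Vec ℤ m} → InjectiveAbs (x ∷ π) → InjectiveAbs π
InjectiveAbs-tail f i j p = Fin.suc-injective (f (suc i) (suc j) p)

InjectiveAbs-fresh : ∀ {m x v} (π : Vec ℤ m) b l → toList π ≡ encode b l → InjectiveAbs (x ∷ π) →
  ∣ x ∣ ≡ suc v → All (v ≢_) (vals l)
InjectiveAbs-fresh π b l e f q =
  All-vals π b l e (λ { i w p refl → contradiction (f zero (suc i) (trans q (sym p))) λ () })

injective⇒Unique : ∀ {m} (π : Vec ℤ m) b l → toList π ≡ encode b l → InjectiveAbs π → Unique (vals l)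
injective⇒Unique π       b []      e f = []
injective⇒Unique (x ∷ π) b (∞ ∷ l) e f = injective⇒Unique π (not b) l (proj₂ (∷-injective e)) (InjectiveAbs-tail f)
injective⇒Unique (x ∷ π) b (up v ∷ l) e f with refl , e′ ← ∷-injective e =
  InjectiveAbs-fresh π (not b) l e′ f (∣signed∣ b v) ∷ injective⇒Unique π (not b) l e′ (InjectiveAbs-tail f)
injective⇒Unique (x ∷ π) b (dn v ∷ l) e f with refl , e′ ← ∷-injective e =
  InjectiveAbs-fresh π (not b) l e′ f (∣signed∣ (not b) v) ∷ injective⇒Unique π (not b) l e′ (InjectiveAbs-tail f)

lookup-vals : ∀ {m} (π : Vec ℤ m) b l → toList π ≡ encode b l → HoleFree l →
  ∀ i → ∃[ v ] (∣ lookup π i ∣ ≡ suc v × v ∈ vals l)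
lookup-vals (x ∷ π) b (∞ ∷ l)    e (() ∷ _) zero
lookup-vals (x ∷ π) b (up v ∷ l) e h zero    with refl , _ ← ∷-injective e = v , ∣signed∣ b v , here refl
lookup-vals (x ∷ π) b (dn v ∷ l) e h zero    with refl , _ ← ∷-injective e = v , ∣signed∣ (not b) v , here refl
lookup-vals (x ∷ π) b (up v ∷ l) e (_ ∷ h) (suc i)
  with w , p , m ← lookup-vals π (not b) l (proj₂ (∷-injective e)) h i = w , p , there m
lookup-vals (x ∷ π) b (dn v ∷ l) e (_ ∷ h) (suc i)
  with w , p , m ← lookup-vals π (not b) l (proj₂ (∷-injective e)) h i = w , p , there m

Unique⇒injective : ∀ {m} (π : Vec ℤ m) b l → toList π ≡ encode b l → HoleFree l → Unique (vals l) → InjectiveAbs π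
Unique⇒injective (x ∷ π) b (t ∷ l) e h q zero zero p = refl
Unique⇒injective (x ∷ π) b (t ∷ l) e (_ ∷ h) q zero (suc j) p
  with refl , e′ ← ∷-injective e
  with v , r , m ← lookup-vals π (not b) l e′ h j = contradiction (trans p r) (head-≢ b t m q)
Unique⇒injective (x ∷ π) b (t ∷ l) e (_ ∷ h) q (suc i) zero p
  with refl , e′ ← ∷-injective e
  with v , r , m ← lookup-vals π (not b) l e′ h i = contradiction (trans (sym p) r) (head-≢ b t m q)
Unique⇒injective (x ∷ π) b (t ∷ l) e (_ ∷ h) q (suc i) (suc j) p =
  cong suc (Unique⇒injective π (not b) l (proj₂ (∷-injective e)) h (Unique-tail t q) i j p)

Bends : Bool → ℤ → ℤ → Set
Bends b x y = if b then x ℤ.> y else x ℤ.< y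

-- At odd positions π_j > π_{j+1}, and at even ones π_j < π_{j+1}, says that ρ_j + ρ_{j+1} > 0.
Bends⇒Adj : ∀ b s t → isHole s ≡ false → isHole t ≡ false → Bends b (tokToℤ b s) (tokToℤ (not b) t) → Adj s t
Bends⇒Adj b     (up v) (up w) _ _ _ = tt
Bends⇒Adj true  (up v) (dn w) _ _ (ℤ.+<+ (s≤s p)) = p
Bends⇒Adj false (up v) (dn w) _ _ (ℤ.-<- p) = p
Bends⇒Adj true  (dn v) (up w) _ _ (ℤ.-<- p) = p
Bends⇒Adj false (dn v) (up w) _ _ (ℤ.+<+ (s≤s p)) = p
Bends⇒Adj true  (dn v) (dn w) _ _ ()
Bends⇒Adj false (dn v) (dn w) _ _ ()

Adj⇒Bends : ∀ b s t → isHole s ≡ false → isHole t ≡ false → Adj s t → Bends b (tokToℤ b s) (tokToℤ (not b) t)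
Adj⇒Bends true  (up v) (up w) _ _ _ = ℤ.-<+
Adj⇒Bends false (up v) (up w) _ _ _ = ℤ.-<+
Adj⇒Bends true  (up v) (dn w) _ _ p = ℤ.+<+ (s≤s p)
Adj⇒Bends false (up v) (dn w) _ _ p = ℤ.-<- p
Adj⇒Bends true  (dn v) (up w) _ _ p = ℤ.-<- p
Adj⇒Bends false (dn v) (up w) _ _ p = ℤ.+<+ (s≤s p)

AlternatingFrom : Bool → List ℤ → Set
AlternatingFrom b xs = ∀ j → suc j < length xs → Bends (flagAt b j) (at xs (suc j)) (at xs (suc (suc j)))

AlternatingFrom⇒Ok : ∀ b t l → HoleFree (t ∷ l) → AlternatingFrom b (encode b (t ∷ l)) → Ok t l
AlternatingFrom⇒Ok b t []      h           f = tt
AlternatingFrom⇒Ok b t (s ∷ l) (p ∷ q ∷ h) f =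
  Bends⇒Adj b t s p q (f 0 (s≤s (s≤s z≤n))) ,
  AlternatingFrom⇒Ok (not b) s l (q ∷ h) (λ j j< → f (suc j) (s≤s j<))

Ok⇒AlternatingFrom : ∀ b t l → HoleFree (t ∷ l) → Ok t l → AlternatingFrom b (encode b (t ∷ l))
Ok⇒AlternatingFrom b t []      h           o       j       (s≤s ())
Ok⇒AlternatingFrom b t (s ∷ l) (p ∷ q ∷ h) (a , o) zero    j<       = Adj⇒Bends b t s p q a
Ok⇒AlternatingFrom b t (s ∷ l) (p ∷ q ∷ h) (a , o) (suc j) (s≤s j<) = Ok⇒AlternatingFrom (not b) s l (q ∷ h) o j j<

Alternating⇒From : ∀ n (π : Vec ℤ n) → Alternating n π → AlternatingFrom true (toList π)
Alternating⇒From n π f j j< = subst (λ b → Bends b (at (toList π) (suc j)) (at (toList π) (suc (suc j))))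
  (sym (flagAt-isOdd j)) (f (suc j) (s≤s z≤n) (subst (suc j <_) (length-toList π) j<))

From⇒Alternating : ∀ n (π : Vec ℤ n) → AlternatingFrom true (toList π) → Alternating n π
From⇒Alternating n π f (suc j) _ j< = subst (λ b → Bends b (at (toList π) (suc j)) (at (toList π) (suc (suc j))))
  (flagAt-isOdd j) (f j (subst (suc j <_) (sym (length-toList π)) j<))

snake⇒Start : ∀ l → HoleFree l → + 0 ℤ.< at (encode true l) 1 → AlternatingFrom true (encode true l) → Start l
snake⇒Start []         _ _  _ = tt
snake⇒Start (∞ ∷ l)    (() ∷ _) _ _
snake⇒Start (up v ∷ l) h _  f = tt , AlternatingFrom⇒Ok true (up v) l h f
snake⇒Start (dn v ∷ l) h () f

Start⇒positive : ∀ t l → HoleFree (t ∷ l) → Start (t ∷ l) → + 0 ℤ.< at (encode true (t ∷ l)) 1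
Start⇒positive ∞      l (() ∷ _) o
Start⇒positive (up v) l h o = ℤ.+<+ (s≤s z≤n)

record Represents (n : ℕ) (π : Vec ℤ n) (l : List Tok) : Set where
  field
    word     : toList π ≡ encode true l
    holeFree : HoleFree l
    values   : vals l ↭ downFrom n
    start    : Start l

snake⇒Represents : ∀ n π → IsSnake n π → Represents n π (decode true (toList π))
snake⇒Represents n π ((range , inj) , pos , alt) = record
  { word = word ; holeFree = hf
  ; values = Unique⇒↭downFrom n (vals l) (injective⇒Unique π true l word inj)
      (All-vals π true l word (λ i v e → subst (_≤ n) e (proj₂ (range i))))
      (trans (length-vals hf) (trans (sym (length-encode true l)) (trans (cong length (sym word)) (length-toList π))))
  ; start = snake⇒Start l hf (subst (λ xs → + 0 ℤ.< at xs 1) word pos) (subst (AlternatingFrom true) word (Alternating⇒From n π alt)) }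
  where
  l : List Tok
  l = decode true (toList π)
  word : toList π ≡ encode true l
  word = sym (encode-decode true (toList π))
  hf : HoleFree l
  hf = nonzero⇒HoleFree π true l word (proj₁ ∘ range)

module _ {n : ℕ} {π : Vec ℤ n} {l : List Tok} (rep : Represents n π l) where
  open Represents rep

  Represents-Unique : Unique (vals l)
  Represents-Unique = Unique-resp-↭ (↭-sym values) (downFrom⁺ n)

  Represents-length : length l ≡ n
  Represents-length = trans (sym (length-encode true l)) (trans (cong length (sym word)) (length-toList π))

  Represents-Φ : ∀ {s} → Decodes 0 s l → length s ≡ n → toList (Φ n π) ≡ s
  Represents-Φ = Decodes-Φ n π l word (length-toList π) Represents-length holeFree Represents-Unique

  Represents-decoded : ∃[ s ] (length s ≡ n × Decodes 0 s l)
  Represents-decoded = Decodes-complete n 0 l (HoleFree⇒holes≡0 holeFree) values start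

  -- Completeness provides some path that decodes to `l`, and Φ is shown to output this very path.
  Represents-Φ-decodes : Decodes 0 (toList (Φ n π)) l
  Represents-Φ-decodes with s , e , x ← Represents-decoded = subst (λ s → Decodes 0 s l) (sym (Represents-Φ x e)) x

  Represents⇒snake : n ≥ 1 → IsSnake n π
  Represents⇒snake n≥1 =
    (range , Unique⇒injective π true l word holeFree Represents-Unique) ,
    subst (λ xs → + 0 ℤ.< at xs 1) (sym word) (positive l Represents-length holeFree start) ,
    From⇒Alternating n π (subst (AlternatingFrom true) (sym word) (alternating l holeFree start))
    where
    range : ∀ i → (1 ≤ ∣ lookup π i ∣) × (∣ lookup π i ∣ ≤ n)
    range i with v , e , m ← lookup-vals π true l word holeFree i rewrite e =
      s≤s z≤n , All.lookup (All-<-downFrom values) m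
    positive : ∀ l → length l ≡ n → HoleFree l → Start l → + 0 ℤ.< at (encode true l) 1
    -- The first letter of the empty word is the default 0, which is not positive; n ≥ 1 excludes
    -- this case.
    positive []      e h o = contradiction (subst (1 ≤_) (sym e) n≥1) λ ()
    positive (t ∷ l) _    h o = Start⇒positive t l h o
    alternating : ∀ l → HoleFree l → Start l → AlternatingFrom true (encode true l)
    alternating []      h o       j ()
    alternating (t ∷ l) h (_ , o) = Ok⇒AlternatingFrom true t l h o

theorem3p1 : (n : ℕ) → n ≥ 1 →
    ((π : Vec ℤ n) → IsSnake n π → IsLabeledBallotPath n (Φ n π))
    × ((π σ : Vec ℤ n) → IsSnake n π → IsSnake n σ → Φ n π ≡ Φ n σ → π ≡ σ)
    × ((s : Vec (Step × ℤ) n) → IsLabeledBallotPath n s →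
    ∃[ π ] (IsSnake n π × Φ n π ≡ s))
theorem3p1 n n≥1 = labeled , injective , surjective
  where
  labeled : ∀ π → IsSnake n π → IsLabeledBallotPath n (Φ n π)
  labeled π snake = Decodes-labeled (Represents-Φ-decodes (snake⇒Represents n π snake))

  injective : ∀ π σ → IsSnake n π → IsSnake n σ → Φ n π ≡ Φ n σ → π ≡ σ
  injective π σ sπ sσ e = toList-injective π σ
    (trans (Represents.word rπ) (trans (cong (encode true) l≡) (sym (Represents.word rσ))))
    where
    rπ : Represents n π (decode true (toList π))
    rπ = snake⇒Represents n π sπ
    rσ : Represents n σ (decode true (toList σ))
    rσ = snake⇒Represents n σ sσ
    -- Both words are decoded from the same path.
    l≡ : decode true (toList π) ≡ decode true (toList σ)
    l≡ = Decodes-unique (Represents-Φ-decodes rπ)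
      (subst (λ s → Decodes 0 s (decode true (toList σ))) (cong toList (sym e)) (Represents-Φ-decodes rσ))

  surjective : ∀ s → IsLabeledBallotPath n s → ∃[ π ] (IsSnake n π × Φ n π ≡ s)
  surjective s lab
    with l , x ← Decodes-exists 0 (toList s) lab
    -- The path starts at height 0, so no recorded hole is left and the word consists of genuine
    -- entries.
    with hf ← holes≡0⇒HoleFree l (Decodes-holes x)
    with vs ← subst (λ k → vals l ↭ downFrom k) (length-toList s) (Decodes-vals x)
    with π , w ← toList-surjective {n = n} (encode true l)
           (trans (length-encode true l) (trans (sym (length-vals hf)) (trans (↭-length vs) (length-downFrom n))))
    with rep ← record { word = w ; holeFree = hf ; values = vs ; start = Decodes-Start x }
    = π , Represents⇒snake rep n≥1 , toList-injective (Φ n π) s (Represents-Φ rep x (length-toList s))
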